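{- Let $\lambda$ be a nonzero real number and let $x,y\in\mathbb{R}$. For every integer $n\ge 0$, \begin{align*} \mathcal{E}_{n,\lambda}^{(c)}(x,y)&=\sum_{k=0}^{n}\binom{n}{k}\mathcal{E}_{k,\lambda}C_{n-k,\lambda}(x,y)\\ &=\sum_{k=0}^{[\frac{n}{2}]}\sum_{l=2k}^{n}\binom{n}{l}\lambda^{l-2k}(-1)^{k}y^{2k}S^{(1)}(l,2k)\mathcal{E}_{n-l,\lambda}(x). \end{align*} Also, for every integer $n\ge 1$, \begin{align*} \mathcal{E}_{n,\lambda}^{(s)}(x,y)&=\sum_{k=0}^{n}\binom{n}{k}\mathcal{E}_{k,\lambda}S_{n-k,\lambda}(x,y)\\ &=\sum_{k=0}^{[\frac{n-1}{2}]}\sum_{l=2k+1}^{n}\binom{n}{l}\lambda^{l-2k-1}(-1)^{k}y^{2k+1}S^{(1)}(l,2k+1)\mathcal{E}_{n-l,\lambda}(x). \end{align*}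
   Context: All generating functions are power series in $t$ around $t=0$. For nonzero $\lambda\in\mathbb{R}$ and complex $z$, the degenerate exponential is $e_\lambda^{z}(t)=(1+\lambda t)^{z/\lambda}$, and $e_\lambda(t)=e_\lambda^1(t)$. The degenerate cosine and sine functions are $\cos_\lambda^{(y)}(t)=\frac{e_\lambda^{iy}(t)+e_\lambda^{ -iy}(t)}{2}=\cos\left(\frac{y}{\lambda}\log(1+\lambda t)\right)$ and $\sin_\lambda^{(y)}(t)=\frac{e_\lambda^{iy}(t)-e_\lambda^{ -iy}(t)}{2i}=\sin\left(\frac{y}{\lambda}\log(1+\lambda t)\right)$, with $i=\sqrt{ -1}$. The degenerate Euler polynomials $\mathcal{E}_{n,\lambda}(x)$ are defined by $\frac{2}{e_\lambda(t)+1}e_\lambda^{x}(t)=\sum_{n=0}^{\infty}\mathcal{E}_{n,\lambda}(x)\frac{t^n}{n!}$, and $\mathcal{E}_{n,\lambda}=\mathcal{E}_{n,\lambda}(0)$. The degenerate cosine-Euler and sine-Euler polynomials are defined by $\frac{2}{e_\lambda(t)+1}e_\lambda^{x}(t)\cos_\lambda^{(y)}(t)=\sum_{n=0}^{\infty}\mathcal{E}_{n,\lambda}^{(c)}(x,y)\frac{t^n}{n!}$ and $\frac{2}{e_\lambda(t)+1}e_\lambda^{x}(t)\sin_\lambda^{(y)}(t)=\sum_{n=0}^{\infty}\mathcal{E}_{n,\lambda}^{(s)}(x,y)\frac{t^n}{n!}$. The degenerate cosine-polynomials and sine-polynomials are defined by $e_\lambda^{x}(t)\cos_\lambda^{(y)}(t)=\sum_{n=0}^{\infty}C_{n,\lambda}(x,y)\frac{t^n}{n!}$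 and $e_\lambda^{x}(t)\sin_\lambda^{(y)}(t)=\sum_{n=0}^{\infty}S_{n,\lambda}(x,y)\frac{t^n}{n!}$. The (signed) Stirling numbers of the first kind $S^{(1)}(n,l)$ are defined by $x(x-1)\cdots(x-n+1)=\sum_{l=0}^{n}S^{(1)}(n,l)x^l$ (the empty product being $1$ for $n=0$). $[a]$ denotes the greatest integer $\le a$. -}

module Defs where

open import Algebra.Apartness.Bundles using (HeytingField; HeytingCommutativeRing)
open import Algebra.Bundles using (CommutativeRing; RawSemiring; Semiring; AbelianGroup)
import Algebra.Construct.DirectProduct as DirectProduct
import Algebra.Definitions
import Algebra.Definitions.RawMonoid
import Algebra.Definitions.RawSemiring
import Algebra.Properties.Ring
import Algebra.Solver.Ring.NaturalCoefficients.Default as NaturalCoefficients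
open import Data.Fin.Base using (toℕ)
open import Data.Integer.Base as ℤ using (ℤ; -[1+_])
import Data.Integer.Properties as ℤ
open import Data.Nat.Base as ℕ using (ℕ; zero; suc; _∸_; _≤_; _!; NonZero)
open import Data.Nat.Properties using (_!≢0)
open import Data.Product.Base using (∃-syntax; _×_; _,_; proj₁; proj₂)
open import Data.Sum.Base using (_⊎_; inj₁; inj₂)
open import Level using (_⊔_) renaming (suc to lsuc)
open import Relation.Binary.Core using (Rel)
open import Relation.Binary.Structures using (IsStrictPartialOrder)
import Relation.Binary.Reasoning.Setoid as SetoidReasoning

module RingNotation {c ℓ} (R : CommutativeRing c ℓ) where
  open CommutativeRing R
  open Algebra.Definitions _≈_ using (Invertible)
  open Algebra.Definitions.RawMonoid +-rawMonoid public
    using (sum) renaming (_×_ to _·_)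
  open Algebra.Definitions.RawSemiring (Semiring.rawSemiring semiring) public using (_^_)

  Unit : Carrier → Set (c ⊔ ℓ)
  Unit = Invertible 1# _*_

  2# : Carrier
  2# = 2 · 1#

  fromℤ : ℤ → Carrier
  fromℤ (ℤ.+ n)  = n · 1#
  fromℤ -[1+ n ] = - (suc n · 1#)

  -- The proof that the divisor is a unit does not influence the quotient up to _≈_.
  infixl 7 _/_[_]
  _/_[_] : Carrier → (d : Carrier) → Unit d → Carrier
  a / _ [ d⁻¹ , _ ] = a * d⁻¹

  -- The sum of f a , … , f b, which is 0# when b < a.
  sumFromTo : ℕ → ℕ → (ℕ → Carrier) → Carrier
  sumFromTo a b f = sum {suc b ∸ a} (λ j → f (a ℕ.+ toℕ j))

  infix 5 sumFromTo
  syntax sumFromTo a b (λ k → e) = Σ[ k from a to b ] e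

  unit : ∀ {d d⁻¹} → d⁻¹ * d ≈ 1# → Unit d
  unit {d} {d⁻¹} p = d⁻¹ , p , trans (*-comm d d⁻¹) p

  unit-resp-≈ : ∀ {a b} → a ≈ b → Unit a → Unit b
  unit-resp-≈ a≈b (a⁻¹ , p , _) = unit (trans (*-congˡ (sym a≈b)) p)

  unit-* : ∀ {a b} → Unit a → Unit b → Unit (a * b)
  unit-* {a} {b} (a⁻¹ , p , _) (b⁻¹ , q , _) = unit (begin
    (b⁻¹ * a⁻¹) * (a * b)  ≈⟨ *-assoc b⁻¹ a⁻¹ (a * b) ⟩
    b⁻¹ * (a⁻¹ * (a * b))  ≈⟨ *-congˡ (*-assoc a⁻¹ a b) ⟨
    b⁻¹ * ((a⁻¹ * a) * b)  ≈⟨ *-congˡ (trans (*-congʳ p) (*-identityˡ b)) ⟩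
    b⁻¹ * b                ≈⟨ q ⟩
    1#                     ∎)
    where open SetoidReasoning setoid

-- Axioms for the complete Archimedean ordered field.  In this constructive form
-- completeness is convergence of Cauchy sequences (with 1/(k+1) as the ε's);
-- "nonzero" is x # 0#, which means x < 0# or 0# < x.
record RealNumbers c ℓ₁ ℓ₂ : Set (lsuc (c ⊔ ℓ₁ ⊔ ℓ₂)) where
  infix 4 _<_
  field
    heytingField : HeytingField c ℓ₁ ℓ₂

  open HeytingField heytingField public

  commutativeRing : CommutativeRing c ℓ₁
  commutativeRing = HeytingCommutativeRing.commutativeRing heytingCommutativeRing

  open RingNotation commutativeRing

  field
    _<_                  : Rel Carrier ℓ₂
    isStrictPartialOrder : IsStrictPartialOrder _≈_ _<_
    #⇒<⊎>                : ∀ {x y} → x # y → x < y ⊎ y < x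
    <⇒#                  : ∀ {x y} → x < y → x # y
    +-monoˡ-<            : ∀ {x y} z → x < y → x + z < y + z
    *-positive           : ∀ {x y} → 0# < x → 0# < y → 0# < x * y
    archimedean          : ∀ x → ∃[ n ] x < n · 1#

  Cauchy : (ℕ → Carrier) → Set ℓ₂
  Cauchy s = ∀ k → ∃[ N ] ∀ m n → N ≤ m → N ≤ n → suc k · (s m - s n) < 1#

  ConvergesTo : (ℕ → Carrier) → Carrier → Set ℓ₂
  ConvergesTo s a = ∀ k → ∃[ N ] ∀ n → N ≤ n →
                    suc k · (s n - a) < 1# × suc k · (a - s n) < 1#

  field
    complete : ∀ s → Cauchy s → ∃[ a ] ConvergesTo s a

module RealUnits {c ℓ₁ ℓ₂} (ℝ : RealNumbers c ℓ₁ ℓ₂) where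
  open RealNumbers ℝ hiding (sym; trans; refl; reflexive)
  open CommutativeRing commutativeRing using (ring; sym; trans; refl)
  open RingNotation commutativeRing
  open Algebra.Properties.Ring ring using (-‿distribˡ-*; -‿involutive; -0#≈0#)
  open IsStrictPartialOrder isStrictPartialOrder
    using (<-respʳ-≈; <-respˡ-≈) renaming (trans to <-trans)

  #0⇒unit : ∀ {x} → x # 0# → Unit x
  #0⇒unit {x} x#0 =
    unit-resp-≈ (trans (+-congˡ -0#≈0#) (+-identityʳ x)) (#⇒invertible x#0)

  0<1 : 0# < 1#
  0<1 with #⇒<⊎> (invertible⇒# (unit {1# - 0#} {1#}
                    (trans (*-identityˡ _) (trans (+-congˡ -0#≈0#) (+-identityʳ 1#)))))
  ... | inj₂ 0<1 = 0<1
  ... | inj₁ 1<0 = <-respʳ-≈ -1*-1≈1 (*-positive 0<-1 0<-1)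
    where
    0<-1 : 0# < - 1#
    0<-1 = <-respˡ-≈ (-‿inverseʳ 1#) (<-respʳ-≈ (+-identityˡ (- 1#)) (+-monoˡ-< (- 1#) 1<0))
    -1*-1≈1 : (- 1#) * (- 1#) ≈ 1#
    -1*-1≈1 = trans (sym (-‿distribˡ-* 1# (- 1#)))
                    (trans (-‿cong (*-identityˡ (- 1#))) (-‿involutive 1#))

  0<suc : ∀ n → 0# < suc n · 1#
  0<suc zero    = <-respʳ-≈ (sym (+-identityʳ 1#)) 0<1
  0<suc (suc n) = <-trans (0<suc n)
    (<-respˡ-≈ (+-identityˡ _) (+-monoˡ-< (suc n · 1#) 0<1))

  ℕ-unit : ∀ n → .{{NonZero n}} → Unit (n · 1#)
  ℕ-unit (suc n) = #0⇒unit (#-sym (<⇒# (0<suc n)))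

module Complex {c ℓ} (R : CommutativeRing c ℓ) where
  private
    module R = CommutativeRing R

  +-abelianGroup : AbelianGroup c ℓ
  +-abelianGroup = DirectProduct.abelianGroup R.+-abelianGroup R.+-abelianGroup

  open AbelianGroup +-abelianGroup public
    using (_≈_)
    renaming (Carrier to ℂ; _∙_ to infixl 6 _+_; _⁻¹ to -_; ε to 0#)

  infixl 7 _*_
  _*_ : ℂ → ℂ → ℂ
  (a , b) * (a′ , b′) = (a R.* a′ R.- b R.* b′) , (a R.* b′ R.+ b R.* a′)

  ofReal : R.Carrier → ℂ
  ofReal a = a , R.0#

  1# i : ℂ
  1# = ofReal R.1#
  i  = R.0# , R.1#

  private
    open NaturalCoefficients R.commutativeSemiring
      using (solve; _:+_; _:*_; _:=_)
    open Algebra.Properties.Ring R.ring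
      using (-‿distribˡ-*; -‿distribʳ-*; -‿+-comm; -‿involutive; -0#≈0#)

    *-cong : ∀ {u v w z} → u ≈ v → w ≈ z → u * w ≈ v * z
    *-cong (p , q) (r , s) =
      R.+-cong (R.*-cong p r) (R.-‿cong (R.*-cong q s)) , R.+-cong (R.*-cong p s) (R.*-cong q r)

    *-comm : ∀ u v → u * v ≈ v * u
    *-comm (a , b) (a′ , b′) =
      R.+-cong (R.*-comm a a′) (R.-‿cong (R.*-comm b b′)) ,
      R.trans (R.+-comm _ _) (R.+-cong (R.*-comm b a′) (R.*-comm a b′))

    -- The solver is for semirings, so negations are first moved onto variables.
    *-assoc : ∀ u v w → (u * v) * w ≈ u * (v * w)
    *-assoc (a , b) (a′ , b′) (a″ , b″) =
      R.trans (R.+-cong (R.*-congʳ (R.+-congˡ (-‿distribʳ-* b b′))) (-‿distribʳ-* _ b″))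
        (R.trans
          (solve 8 (λ a b c d e f d⁻ f⁻ →
            (a :* c :+ b :* d⁻) :* e :+ (a :* d :+ b :* c) :* f⁻ :=
            a :* (c :* e :+ d :* f⁻) :+ b :* (c :* f⁻ :+ d⁻ :* e))
            R.refl a b a′ b′ a″ b″ (R.- b′) (R.- b″))
          (R.sym (R.+-cong (R.*-congˡ (R.+-congˡ (-‿distribʳ-* b′ b″)))
            (R.trans (-‿distribʳ-* b _) (R.*-congˡ
              (R.trans (R.sym (-‿+-comm _ _))
                (R.+-cong (-‿distribʳ-* a′ b″) (-‿distribˡ-* b′ a″)))))))) ,
      R.trans (R.+-congʳ (R.*-congʳ (R.+-congˡ (-‿distribʳ-* b b′))))
        (R.trans
          (solve 7 (λ a b c d e f d⁻ →
            (a :* c :+ b :* d⁻) :* f :+ (a :* d :+ b :* c) :* e :=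
            a :* (c :* f :+ d :* e) :+ b :* (c :* e :+ d⁻ :* f))
            R.refl a b a′ b′ a″ b″ (R.- b′))
          (R.sym (R.+-congˡ (R.*-congˡ (R.+-congˡ (-‿distribˡ-* b′ b″))))))

    *-distribˡ-+ : ∀ u v w → u * (v + w) ≈ u * v + u * w
    *-distribˡ-+ (a , b) (a′ , b′) (a″ , b″) =
      R.trans (R.+-congˡ (-‿distribˡ-* b _))
        (R.trans
          (solve 6 (λ a b⁻ c d e f →
            a :* (c :+ e) :+ b⁻ :* (d :+ f) :=
            (a :* c :+ b⁻ :* d) :+ (a :* e :+ b⁻ :* f))
            R.refl a (R.- b) a′ b′ a″ b″)
          (R.sym (R.+-cong (R.+-congˡ (-‿distribˡ-* b b′)) (R.+-congˡ (-‿distribˡ-* b b″))))) ,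
      solve 6 (λ a b c d e f →
        a :* (d :+ f) :+ b :* (c :+ e) :=
        (a :* d :+ b :* c) :+ (a :* f :+ b :* e)) R.refl a b a′ b′ a″ b″

    x-0≈x : ∀ x → x R.- R.0# R.≈ x
    x-0≈x x = R.trans (R.+-congˡ -0#≈0#) (R.+-identityʳ x)

    *-identityˡ : ∀ u → 1# * u ≈ u
    *-identityˡ (a , b) =
      R.trans (R.+-cong (R.*-identityˡ a) (R.-‿cong (R.zeroˡ b))) (x-0≈x a) ,
      R.trans (R.+-cong (R.*-identityˡ b) (R.zeroˡ a)) (R.+-identityʳ b)

    open AbelianGroup +-abelianGroup using (trans) renaming (∙-cong to +-cong)

  commutativeRing : CommutativeRing c ℓ
  commutativeRing = record
    { Carrier = ℂ
    ; _≈_ = _≈_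
    ; _+_ = _+_
    ; _*_ = _*_
    ; -_  = -_
    ; 0#  = 0#
    ; 1#  = 1#
    ; isCommutativeRing = record
      { isRing = record
        { +-isAbelianGroup = AbelianGroup.isAbelianGroup +-abelianGroup
        ; *-cong     = *-cong
        ; *-assoc    = *-assoc
        ; *-identity = *-identityˡ , λ u → trans (*-comm u 1#) (*-identityˡ u)
        ; distrib    = *-distribˡ-+ , λ u v w →
            trans (*-comm (v + w) u)
              (trans (*-distribˡ-+ u v w) (+-cong (*-comm u v) (*-comm u w)))
        }
      ; *-comm = *-comm
      }
    }

  private
    module Rₙ = RingNotation R
    module Cₙ = RingNotation commutativeRing

  ofReal-unit : ∀ {a} → Rₙ.Unit a → Cₙ.Unit (ofReal a)
  ofReal-unit {a} (a⁻¹ , p , _) = Cₙ.unit {ofReal a} {ofReal a⁻¹}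
    ( R.trans (R.+-congˡ (R.-‿cong (R.zeroˡ _))) (R.trans (x-0≈x _) p)
    , R.trans (R.+-cong (R.zeroʳ _) (R.zeroˡ _)) (R.+-identityʳ _))

  ofReal-· : ∀ n → ofReal (n Rₙ.· R.1#) ≈ n Cₙ.· 1#
  ofReal-· zero    = R.refl , R.refl
  ofReal-· (suc n) =
    R.+-congˡ (proj₁ (ofReal-· n)) ,
    R.trans (R.sym (R.+-identityˡ R.0#)) (R.+-congˡ (proj₂ (ofReal-· n)))

  i-unit : Cₙ.Unit i
  i-unit = Cₙ.unit {i} { - i}
    ( R.trans (R.+-cong (R.zeroʳ _) (R.-‿cong (R.*-identityʳ _)))
        (R.trans (R.+-identityˡ _) (-‿involutive R.1#))
    , R.trans (R.+-cong (R.trans (R.*-identityʳ _) -0#≈0#) (R.zeroʳ _)) (R.+-identityˡ _))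

-- A formal power series is its sequence of coefficients.
module PowerSeries {c ℓ} (R : CommutativeRing c ℓ) where
  open CommutativeRing R
  open RingNotation R

  Series : Set c
  Series = ℕ → Carrier

  const : Carrier → Series
  const a zero    = a
  const a (suc _) = 0#

  X : Series
  X 1 = 1#
  X _ = 0#

  infixl 7 _∙_
  _∙_ : Carrier → Series → Series
  (a ∙ f) n = a * f n

  rawSemiring : RawSemiring c ℓ
  rawSemiring = record
    { Carrier = Series
    ; _≈_ = λ f g → ∀ n → f n ≈ g n
    ; _+_ = λ f g n → f n + g n
    ; _*_ = λ f g n → Σ[ k from 0 to n ] (f k * g (n ∸ k))
    ; 0#  = const 0#
    ; 1#  = const 1#
    }

  open RawSemiring rawSemiring public
    using () renaming (_≈_ to _≈ₛ_; _+_ to _+ₛ_; _*_ to _*ₛ_; 1# to 1ₛ)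
  open Algebra.Definitions.RawSemiring rawSemiring public
    using () renaming (_^_ to _^ₛ_)

  infixl 6 _-ₛ_
  _-ₛ_ : Series → Series → Series
  (f -ₛ g) n = f n - g n

  -- f (u (t)).  Only meaningful when u has zero constant term: then u ^ k has no
  -- coefficient of degree less than k, so the truncation at k = n loses nothing.
  infixr 9 _⟨_⟩
  _⟨_⟩ : Series → Series → Series
  (f ⟨ u ⟩) n = Σ[ k from 0 to n ] (f k * (u ^ₛ k) n)

  geometric : Series
  geometric _ = 1#

  -- f / g, as f · g₀⁻¹ · 1 / (1 - u) with u = 1 - g₀⁻¹ · g.
  infixl 7 _/ₛ_[_]
  _/ₛ_[_] : Series → (g : Series) → Unit (g 0) → Series
  f /ₛ g [ g₀⁻¹ , _ ] = f *ₛ (g₀⁻¹ ∙ geometric ⟨ 1ₛ -ₛ (g₀⁻¹ ∙ g) ⟩)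

module ExpLog {c ℓ} (R : CommutativeRing c ℓ)
  (ℕ-unit : ∀ n → .{{NonZero n}} →
            RingNotation.Unit R (RingNotation._·_ R n (CommutativeRing.1# R))) where

  open CommutativeRing R
  open RingNotation R
  open PowerSeries R

  exp : Series
  exp n = 1# / (n !) · 1# [ ℕ-unit (n !) {{n !≢0}} ]

  -- log (1 + t)
  log1+ : Series
  log1+ zero    = 0#
  log1+ (suc n) = (- 1#) ^ n / suc n · 1# [ ℕ-unit (suc n) ]

  -- (1 + u) ^ a = exp (a log (1 + u)), for u with zero constant term.
  power1+ : Series → Carrier → Series
  power1+ u a = exp ⟨ a ∙ log1+ ⟨ u ⟩ ⟩

  -- The sequence a with f = Σ aₙ tⁿ / n!.
  egfCoefficient : Series → ℕ → Carrier
  egfCoefficient f n = (n !) · f n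

  power1+-constant : ∀ u a → power1+ u a 0 ≈ 1#
  power1+-constant u a = begin
    (1# * 0!⁻¹) * 1# + 0#  ≈⟨ +-identityʳ _ ⟩
    (1# * 0!⁻¹) * 1#       ≈⟨ *-congʳ (*-identityˡ 0!⁻¹) ⟩
    0!⁻¹ * 1#              ≈⟨ *-congˡ (+-identityʳ 1#) ⟨
    0!⁻¹ * (1 · 1#)        ≈⟨ proj₁ (proj₂ (ℕ-unit 1)) ⟩
    1#                     ∎
    where
    open SetoidReasoning setoid
    0!⁻¹ = proj₁ (ℕ-unit 1)

module Stirling where
  open PowerSeries ℤ.+-*-commutativeRing

  -- The polynomial x (x - 1) ⋯ (x - n + 1) over ℤ, by its coefficients.
  fallingFactorial : ℕ → Series
  fallingFactorial zero    = 1ₛ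
  fallingFactorial (suc n) = fallingFactorial n *ₛ (X -ₛ const (ℤ.+ n))

  S⁽¹⁾ : ℕ → ℕ → ℤ
  S⁽¹⁾ n l = fallingFactorial n l

module ComplexNumbers {c ℓ₁ ℓ₂} (ℝ : RealNumbers c ℓ₁ ℓ₂) where
  open Complex (RealNumbers.commutativeRing ℝ) public using (ℂ; ofReal; i; i-unit)
  open Complex (RealNumbers.commutativeRing ℝ)
    using (commutativeRing; ofReal-·; ofReal-unit)
  open CommutativeRing commutativeRing public hiding (Carrier)
  open RingNotation commutativeRing public
  open PowerSeries commutativeRing public

  ℕ-unit : ∀ n → .{{NonZero n}} → Unit (n · 1#)
  ℕ-unit n = unit-resp-≈ (ofReal-· n) (ofReal-unit (RealUnits.ℕ-unit ℝ n))

  open ExpLog commutativeRing ℕ-unit public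

-- lam is the parameter λ (a reserved symbol in Agda), X the variable t; e^ z, cos^ y and
-- sin^ y are e_λ^z(t), cos_λ^(y)(t) and sin_λ^(y)(t), with complex coefficients.
module Degenerate {c ℓ₁ ℓ₂} (ℝ : RealNumbers c ℓ₁ ℓ₂)
  (lam : RealNumbers.Carrier ℝ)
  (lam#0 : RealNumbers._#_ ℝ lam (RealNumbers.0# ℝ)) where

  open RealNumbers ℝ using () renaming (Carrier to Real; 0# to 0ᴿ)
  open ComplexNumbers ℝ

  lam-unit : Unit (ofReal lam)
  lam-unit = Complex.ofReal-unit (RealNumbers.commutativeRing ℝ) (RealUnits.#0⇒unit ℝ lam#0)

  e^ : ℂ → Series
  e^ z = power1+ (ofReal lam ∙ X) (z / ofReal lam [ lam-unit ])

  cos^ sin^ : Real → Series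
  cos^ y n = (e^ (i * ofReal y) n + e^ (- (i * ofReal y)) n) / 2# [ ℕ-unit 2 ]
  sin^ y n = (e^ (i * ofReal y) n - e^ (- (i * ofReal y)) n)
             / 2# * i [ unit-* (ℕ-unit 2) i-unit ]

  e+1-constant-unit : Unit ((e^ 1# +ₛ 1ₛ) 0)
  e+1-constant-unit = unit-resp-≈
    (+-cong (sym (power1+-constant (ofReal lam ∙ X) (1# / ofReal lam [ lam-unit ])))
            (+-identityʳ 1#))
    (ℕ-unit 2)

  2/[e+1] : Series
  2/[e+1] = const 2# /ₛ (e^ 1# +ₛ 1ₛ) [ e+1-constant-unit ]

  𝓔 : ℕ → Real → ℂ
  𝓔 n x = egfCoefficient (2/[e+1] *ₛ e^ (ofReal x)) n

  𝓔₀ : ℕ → ℂ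
  𝓔₀ n = 𝓔 n 0ᴿ

  𝓔⁽ᶜ⁾ 𝓔⁽ˢ⁾ 𝓒 𝓢 : ℕ → Real → Real → ℂ
  𝓔⁽ᶜ⁾ n x y = egfCoefficient (2/[e+1] *ₛ e^ (ofReal x) *ₛ cos^ y) n
  𝓔⁽ˢ⁾ n x y = egfCoefficient (2/[e+1] *ₛ e^ (ofReal x) *ₛ sin^ y) n
  𝓒    n x y = egfCoefficient (e^ (ofReal x) *ₛ cos^ y) n
  𝓢    n x y = egfCoefficient (e^ (ofReal x) *ₛ sin^ y) n

{-# OPTIONS --safe #-}

-- Since (1 + t) · d/dt log (1 + t) = 1, the numbers n! [tⁿ] (log (1 + t))ᵏ satisfy the
-- recurrence that characterises k! S⁽¹⁾(n, k).  Hence the nth exponential coefficient of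
-- e_λ^z(t) = Σₖ zᵏ (log (1 + λt) / λ)ᵏ / k! is Σₖ λⁿ⁻ᵏ zᵏ S⁽¹⁾(n, k).  At z = ± i y the odd
-- powers cancel in the cosine and the even ones in the sine.  Both expansions then come
-- from the binomial convolution of exponential generating functions, the second one after
-- exchanging the order of summation.
module Submission where

open import Defs
open import Algebra.Apartness.Bundles using (HeytingField)
open import Algebra.Bundles using (CommutativeMonoid; CommutativeRing; CommutativeSemiring)
import Algebra.Properties.CommutativeSemigroup as CommutativeSemigroupProperties
import Algebra.Properties.CommutativeMonoid.Mult
import Algebra.Properties.CommutativeSemiring.Exp
import Algebra.Properties.Ring
import Algebra.Properties.Semiring.Mult
import Algebra.Properties.Semiring.Sum
import Algebra.Solver.Ring.NaturalCoefficients.Default as NaturalCoefficients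
open import Algebra.Structures.Biased using (isCommutativeMonoidˡ; isCommutativeSemiringˡ)
open import Data.Fin.Base using (toℕ)
open import Data.Fin.Properties using (toℕ≤pred[n])
import Data.Integer.Base as ℤ
import Data.Integer.Properties as ℤ
import Data.Integer.Solver
open import Data.Nat.Base
  using (ℕ; zero; suc; _∸_; _≤_; _<_; z≤n; s≤s; ⌊_/2⌋; _!; NonZero)
  renaming (_*_ to _*ℕ_; _+_ to _+ℕ_)
open import Data.Nat.Combinatorics using (_C_; nCk≡n!/k![n-k]!; k![n∸k]!∣n!)
open import Data.Nat.DivMod using (m/n*n≡m)
import Data.Nat.Properties as ℕ
open import Data.Product.Base using (_×_; _,_; proj₁; proj₂)
open import Function.Base using (_∘_; _$_)
open import Relation.Binary.Structures using (IsEquivalence)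
open import Relation.Binary.PropositionalEquality as ≡ using (_≡_)
import Relation.Binary.Reasoning.Setoid as SetoidReasoning

-- The obstacle is composition of series, which is only a truncated sum. It is met in two forms that
-- can be computed coefficient by coefficient. The outer substitution, into `exp`, is by definition
-- the finite sum of [tⁿ] vᵏ / k!, so everything rests on the powers of v. The inner one, λt into
-- the logarithm, multiplies the coefficient of tⁿ by λⁿ, and this scaling is multiplicative; hence
-- powers of log (1 + λt) come from powers of log (1 + t). The derivation used is t d/dt, because it
-- multiplies the coefficient of tⁿ by n without shifting indices. The argument runs over an
-- arbitrary commutative ring in which the positive integers are units, later with a chosen square
-- root of -1, and with 2/(e_λ(t) + 1) replaced by a variable series. The complex numbers are put in
-- only at the end, which keeps concrete series out of the calculations.

n!≡nCk*[k!*[n∸k]!] : ∀ {n k} → k ≤ n → n ! ≡ (n C k) *ℕ (k ! *ℕ (n ∸ k) !)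
n!≡nCk*[k!*[n∸k]!] {n} {k} k≤n = ≡.sym $ ≡.trans
  (≡.cong (_*ℕ (k ! *ℕ (n ∸ k) !)) (nCk≡n!/k![n-k]! k≤n))
  (m/n*n≡m (k![n∸k]!∣n! k≤n))
  where instance _ = k ℕ.!* (n ∸ k) !≢0

-- Finite sums.

module SumProperties {c ℓ} (R : CommutativeRing c ℓ) where
  open CommutativeRing R
  open RingNotation R
  open Algebra.Properties.Semiring.Sum semiring
    using (sum-cong-≋; ∑-distrib-+; ∑-comm; *-distribˡ-sum; *-distribʳ-sum)
  open Algebra.Properties.Semiring.Mult semiring using (×-congʳ; ×-assoc-*)
  open SetoidReasoning setoid

  ·-as-* : ∀ n x → n · x ≈ (n · 1#) * x
  ·-as-* n x = sym (trans (×-assoc-* n 1# x) (×-congʳ n (*-identityˡ x)))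

  Σ₀-cong : ∀ n {f g} → (∀ k → k ≤ n → f k ≈ g k) → sumFromTo 0 n f ≈ sumFromTo 0 n g
  Σ₀-cong n f≈g = sum-cong-≋ {suc n} λ j → f≈g (toℕ j) (toℕ≤pred[n] j)

  Σ-cong : ∀ a b {f g} → (∀ k → f k ≈ g k) → sumFromTo a b f ≈ sumFromTo a b g
  Σ-cong a b f≈g = sum-cong-≋ {suc b ∸ a} λ j → f≈g (a +ℕ toℕ j)

  Σ₀-0 : ∀ n {f} → (∀ k → f k ≈ 0#) → sumFromTo 0 n f ≈ 0#
  Σ₀-0 zero    f≈0 = trans (+-identityʳ _) (f≈0 0)
  Σ₀-0 (suc n) f≈0 = trans (+-cong (f≈0 0) (Σ₀-0 n (f≈0 ∘ suc))) (+-identityˡ 0#)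

  *-distribˡ-Σ₀ : ∀ x n f → x * sumFromTo 0 n f ≈ Σ[ k from 0 to n ] (x * f k)
  *-distribˡ-Σ₀ x n f = *-distribˡ-sum {suc n} x (f ∘ toℕ)

  *-distribʳ-Σ₀ : ∀ x n f → sumFromTo 0 n f * x ≈ Σ[ k from 0 to n ] (f k * x)
  *-distribʳ-Σ₀ x n f = *-distribʳ-sum {suc n} x (f ∘ toℕ)

  ·-distrib-Σ₀ : ∀ m n f → m · sumFromTo 0 n f ≈ Σ[ k from 0 to n ] (m · f k)
  ·-distrib-Σ₀ m n f = begin
    m · sumFromTo 0 n f                   ≈⟨ ·-as-* m _ ⟩
    (m · 1#) * sumFromTo 0 n f            ≈⟨ *-distribˡ-Σ₀ (m · 1#) n f ⟩
    Σ[ k from 0 to n ] ((m · 1#) * f k)   ≈⟨ Σ-cong 0 n (λ k → ·-as-* m (f k)) ⟨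
    Σ[ k from 0 to n ] (m · f k)          ∎

  Σ₀-distrib-+ : ∀ n f g →
    Σ[ k from 0 to n ] (f k + g k) ≈ sumFromTo 0 n f + sumFromTo 0 n g
  Σ₀-distrib-+ n f g = ∑-distrib-+ {suc n} (f ∘ toℕ) (g ∘ toℕ)

  Σ₀-comm : ∀ m n (f : ℕ → ℕ → Carrier) →
    Σ[ j from 0 to m ] (Σ[ k from 0 to n ] f j k) ≈ Σ[ k from 0 to n ] (Σ[ j from 0 to m ] f j k)
  Σ₀-comm m n f = ∑-comm {suc m} {suc n} λ j k → f (toℕ j) (toℕ k)

  Σ₀-extend : ∀ {m n} f → m ≤ n → (∀ k → m < k → f k ≈ 0#) →
    sumFromTo 0 m f ≈ sumFromTo 0 n f
  Σ₀-extend {n = zero}  f z≤n       f≈0 = refl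
  Σ₀-extend {n = suc n} f z≤n       f≈0 = +-congˡ (sym (Σ₀-0 n λ k → f≈0 (suc k) (s≤s z≤n)))
  Σ₀-extend             f (s≤s m≤n) f≈0 =
    +-congˡ (Σ₀-extend (f ∘ suc) m≤n λ k m<k → f≈0 (suc k) (s≤s m<k))

  Σ₀-drop : ∀ a b f → (∀ k → k < a → f k ≈ 0#) → sumFromTo 0 b f ≈ sumFromTo a b f
  Σ₀-drop zero          b       f f≈0 = refl
  -- Here the sum from `a` is empty. Its length reduces to `0 ∸ _`, which evaluates only once the
  -- head constructor of the subtrahend is known, hence two clauses with the same proof.
  Σ₀-drop (suc zero)    zero    f f≈0 = trans (+-identityʳ _) (f≈0 0 (s≤s z≤n))
  Σ₀-drop (suc (suc _)) zero    f f≈0 = trans (+-identityʳ _) (f≈0 0 (s≤s z≤n))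
  Σ₀-drop (suc a)       (suc b) f f≈0 =
    trans (+-cong (f≈0 0 (s≤s z≤n)) (Σ₀-drop a b (f ∘ suc) λ k k<a → f≈0 (suc k) (s≤s k<a)))
          (+-identityˡ _)

  -- Induction in steps of two, the way `⌊ n /2⌋` computes. The index has to be rewritten because
  -- `2 *ℕ suc k` does not reduce to `suc (suc (2 *ℕ k))`.
  Σ₀-even : ∀ n f → (∀ k → f (suc (2 *ℕ k)) ≈ 0#) →
    sumFromTo 0 n f ≈ Σ[ k from 0 to ⌊ n /2⌋ ] f (2 *ℕ k)
  Σ₀-even zero          f f-odd = refl
  Σ₀-even (suc zero)    f f-odd =
    +-congˡ (trans (+-identityʳ _) (f-odd 0))
  Σ₀-even (suc (suc n)) f f-odd = +-congˡ $ begin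
    f 1 + sumFromTo 0 n (f ∘ suc ∘ suc)                ≈⟨ +-congʳ (f-odd 0) ⟩
    0# + sumFromTo 0 n (f ∘ suc ∘ suc)                 ≈⟨ +-identityˡ _ ⟩
    sumFromTo 0 n (f ∘ suc ∘ suc)                      ≈⟨ Σ₀-even n (f ∘ suc ∘ suc) (λ k →
      trans (reflexive (≡.cong (f ∘ suc) (≡.sym (ℕ.*-suc 2 k)))) (f-odd (suc k))) ⟩
    Σ[ k from 0 to ⌊ n /2⌋ ] f (suc (suc (2 *ℕ k)))    ≈⟨ Σ-cong 0 ⌊ n /2⌋ (λ k →
      reflexive (≡.cong f (≡.sym (ℕ.*-suc 2 k)))) ⟩
    Σ[ k from 0 to ⌊ n /2⌋ ] f (2 *ℕ suc k)            ∎

  -- Shifting the index by one turns odd positions into even ones. At n = 0 truncated subtraction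
  -- would leave the term `f 1` on the right, where the floor of -1/2 gives an empty sum; this is
  -- why 1 ≤ n is assumed.
  Σ₀-odd : ∀ n f → 1 ≤ n → (∀ k → f (2 *ℕ k) ≈ 0#) →
    sumFromTo 0 n f ≈ Σ[ k from 0 to ⌊ n ∸ 1 /2⌋ ] f (suc (2 *ℕ k))
  Σ₀-odd (suc n) f _ f-even = begin
    f 0 + sumFromTo 0 n (f ∘ suc)  ≈⟨ +-congʳ (f-even 0) ⟩
    0# + sumFromTo 0 n (f ∘ suc)   ≈⟨ +-identityˡ _ ⟩
    sumFromTo 0 n (f ∘ suc)        ≈⟨ Σ₀-even n (f ∘ suc) (λ k →
      trans (reflexive (≡.cong f (≡.sym (ℕ.*-suc 2 k)))) (f-even (suc k))) ⟩
    Σ[ k from 0 to ⌊ n /2⌋ ] f (suc (2 *ℕ k)) ∎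

-- The commutative semiring of power series.

module SeriesProperties {c ℓ} (R : CommutativeRing c ℓ) where
  open CommutativeRing R
  open RingNotation R
  open PowerSeries R
  open SumProperties R
  open CommutativeSemigroupProperties
    (CommutativeMonoid.commutativeSemigroup +-commutativeMonoid)
    using (x∙yz≈y∙xz)
  open SetoidReasoning setoid

  const-0# : ∀ n → const 0# n ≈ 0#
  const-0# zero    = refl
  const-0# (suc n) = refl

  *ₛ-cong : ∀ {f f′ g g′} → f ≈ₛ f′ → g ≈ₛ g′ → f *ₛ g ≈ₛ f′ *ₛ g′
  *ₛ-cong f≈f′ g≈g′ n = Σ-cong 0 n λ k → *-cong (f≈f′ k) (g≈g′ (n ∸ k))

  *ₛ-zeroˡ : ∀ {f} g → (∀ n → f n ≈ 0#) → ∀ n → (f *ₛ g) n ≈ 0#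
  *ₛ-zeroˡ g f≈0 n = Σ₀-0 n λ k → trans (*-congʳ (f≈0 k)) (zeroˡ (g (n ∸ k)))

  *ₛ-distribʳ-+ₛ : ∀ h f g → (f +ₛ g) *ₛ h ≈ₛ f *ₛ h +ₛ g *ₛ h
  *ₛ-distribʳ-+ₛ h f g n = trans
    (Σ-cong 0 n λ k → distribʳ (h (n ∸ k)) (f k) (g k))
    (Σ₀-distrib-+ n (λ k → f k * h (n ∸ k)) (λ k → g k * h (n ∸ k)))

  *ₛ-∙ˡ : ∀ a f g → (a ∙ f) *ₛ g ≈ₛ a ∙ (f *ₛ g)
  *ₛ-∙ˡ a f g n = trans
    (Σ-cong 0 n λ k → *-assoc a (f k) (g (n ∸ k)))
    (sym (*-distribˡ-Σ₀ a n λ k → f k * g (n ∸ k)))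

  -- The Cauchy product unfolds definitionally by splitting off the constant coefficient of the left
  -- factor. This is the mirror image for the right factor, from which commutativity follows by
  -- induction.
  *ₛ-suc : ∀ f g n → (f *ₛ g) (suc n) ≈ f (suc n) * g 0 + (f *ₛ (g ∘ suc)) n
  *ₛ-suc f g zero    = begin
    f 0 * g 1 + (f 1 * g 0 + 0#)  ≈⟨ x∙yz≈y∙xz _ _ _ ⟩
    f 1 * g 0 + (f 0 * g 1 + 0#)  ∎
  *ₛ-suc f g (suc n) = begin
    f 0 * g (suc (suc n)) + ((f ∘ suc) *ₛ g) (suc n)
      ≈⟨ +-congˡ (*ₛ-suc (f ∘ suc) g n) ⟩
    f 0 * g (suc (suc n)) + (f (suc (suc n)) * g 0 + ((f ∘ suc) *ₛ (g ∘ suc)) n)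
      ≈⟨ x∙yz≈y∙xz _ _ _ ⟩
    f (suc (suc n)) * g 0 + (f *ₛ (g ∘ suc)) (suc n) ∎

  *ₛ-comm : ∀ f g → f *ₛ g ≈ₛ g *ₛ f
  *ₛ-comm f g zero    = +-congʳ (*-comm (f 0) (g 0))
  *ₛ-comm f g (suc n) = trans
    (+-cong (*-comm (f 0) (g (suc n))) (*ₛ-comm (f ∘ suc) g n))
    (sym (*ₛ-suc g f n))

  -- Induction on the degree instead of reindexing a double sum: the shift of `f *ₛ g` is
  -- definitionally `f 0 ∙ (g ∘ suc) +ₛ (f ∘ suc) *ₛ g`, so distributivity and the induction
  -- hypothesis for `f ∘ suc` suffice.
  *ₛ-assoc : ∀ f g h → (f *ₛ g) *ₛ h ≈ₛ f *ₛ (g *ₛ h)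
  *ₛ-assoc f g h zero    = +-congʳ (begin
    (f 0 * g 0 + 0#) * h 0    ≈⟨ *-congʳ (+-identityʳ _) ⟩
    f 0 * g 0 * h 0           ≈⟨ *-assoc (f 0) (g 0) (h 0) ⟩
    f 0 * (g 0 * h 0)         ≈⟨ *-congˡ (+-identityʳ _) ⟨
    f 0 * (g 0 * h 0 + 0#)    ∎)
  *ₛ-assoc f g h (suc n) = begin
    (f *ₛ g) 0 * h (suc n) + ((f 0 ∙ (g ∘ suc) +ₛ (f ∘ suc) *ₛ g) *ₛ h) n
      ≈⟨ +-cong (trans (*-congʳ (+-identityʳ _)) (*-assoc (f 0) (g 0) (h (suc n))))
                (*ₛ-distribʳ-+ₛ h (f 0 ∙ (g ∘ suc)) ((f ∘ suc) *ₛ g) n) ⟩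
    f 0 * (g 0 * h (suc n)) + (((f 0 ∙ (g ∘ suc)) *ₛ h) n + (((f ∘ suc) *ₛ g) *ₛ h) n)
      ≈⟨ +-congˡ (+-cong (*ₛ-∙ˡ (f 0) (g ∘ suc) h n) (*ₛ-assoc (f ∘ suc) g h n)) ⟩
    f 0 * (g 0 * h (suc n)) + (f 0 * ((g ∘ suc) *ₛ h) n + ((f ∘ suc) *ₛ (g *ₛ h)) n)
      ≈⟨ +-assoc _ _ _ ⟨
    f 0 * (g 0 * h (suc n)) + f 0 * ((g ∘ suc) *ₛ h) n + ((f ∘ suc) *ₛ (g *ₛ h)) n
      ≈⟨ +-congʳ (distribˡ _ _ _) ⟨
    f 0 * (g *ₛ h) (suc n) + ((f ∘ suc) *ₛ (g *ₛ h)) n ∎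

  *ₛ-identityˡ : ∀ f → 1ₛ *ₛ f ≈ₛ f
  *ₛ-identityˡ f zero    = trans (+-identityʳ _) (*-identityˡ (f 0))
  *ₛ-identityˡ f (suc n) = trans
    (+-cong (*-identityˡ (f (suc n))) (*ₛ-zeroˡ f (λ _ → refl) n))
    (+-identityʳ _)

  -- A series whose shift is `1ₛ` is a linear polynomial c + t. The cases of interest are t itself
  -- and the factors t - n of the falling factorial.
  *ₛ-sucˡ-1ₛ : ∀ {f} → f ∘ suc ≈ₛ 1ₛ → ∀ g n → (f *ₛ g) (suc n) ≈ f 0 * g (suc n) + g n
  *ₛ-sucˡ-1ₛ f-suc g n =
    +-congˡ (trans (*ₛ-cong {g = g} f-suc (λ _ → refl) n) (*ₛ-identityˡ g n))

  seriesSemiring : CommutativeSemiring c ℓ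
  seriesSemiring = record
    { Carrier = Series
    ; _≈_ = _≈ₛ_
    ; _+_ = _+ₛ_
    ; _*_ = _*ₛ_
    ; 0#  = const 0#
    ; 1#  = 1ₛ
    ; isCommutativeSemiring = isCommutativeSemiringˡ record
      { +-isCommutativeMonoid = isCommutativeMonoidˡ record
        { isSemigroup = record
          { isMagma = record
            { isEquivalence = isEquivalenceₛ
            ; ∙-cong = λ p q n → +-cong (p n) (q n)
            }
          ; assoc = λ f g h n → +-assoc (f n) (g n) (h n)
          }
        ; identityˡ = λ f n → trans (+-congʳ (const-0# n)) (+-identityˡ (f n))
        ; comm = λ f g n → +-comm (f n) (g n)
        }
      ; *-isCommutativeMonoid = isCommutativeMonoidˡ record
        { isSemigroup = record
          { isMagma = record
            { isEquivalence = isEquivalenceₛ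
            ; ∙-cong = *ₛ-cong
            }
          ; assoc = *ₛ-assoc
          }
        ; identityˡ = *ₛ-identityˡ
        ; comm = *ₛ-comm
        }
      ; distribʳ = *ₛ-distribʳ-+ₛ
      ; zeroˡ    = λ f n → trans (*ₛ-zeroˡ f const-0# n) (sym (const-0# n))
      }
    }
    where
    isEquivalenceₛ : IsEquivalence _≈ₛ_
    isEquivalenceₛ = record
      { refl  = λ {f} n → refl {f n}
      ; sym   = λ p n → sym (p n)
      ; trans = λ p q n → trans (p n) (q n)
      }

module SeriesSemiring {c ℓ} (R : CommutativeRing c ℓ) where
  open CommutativeSemiring (SeriesProperties.seriesSemiring R) public
  open Algebra.Properties.Semiring.Mult semiring public using (_×_; ×-congʳ; ×-comm-*)
  open Algebra.Properties.CommutativeSemiring.Exp (SeriesProperties.seriesSemiring R) public using (^-congˡ)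
  open NaturalCoefficients (SeriesProperties.seriesSemiring R) public using (solve; _:*_; _:=_)
  module Reasoning = SetoidReasoning setoid

-- Scalars, multiplication by t and substitution of a multiple of t.

module SeriesOperations {c ℓ} (R : CommutativeRing c ℓ) where
  open CommutativeRing R
  open RingNotation R
  open PowerSeries R
  open SumProperties R
  open SeriesProperties R
  open NaturalCoefficients commutativeSemiring using (solve; _:*_; _:=_)
  open SetoidReasoning setoid
  *ₛ-∙ʳ : ∀ a f g → f *ₛ (a ∙ g) ≈ₛ a ∙ (f *ₛ g)
  *ₛ-∙ʳ a f g n = begin
    (f *ₛ (a ∙ g)) n  ≈⟨ *ₛ-comm f (a ∙ g) n ⟩
    ((a ∙ g) *ₛ f) n  ≈⟨ *ₛ-∙ˡ a g f n ⟩
    a * (g *ₛ f) n    ≈⟨ *-congˡ (*ₛ-comm g f n) ⟩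
    a * (f *ₛ g) n    ∎

  ∙-^ₛ : ∀ a f k → (a ∙ f) ^ₛ k ≈ₛ a ^ k ∙ (f ^ₛ k)
  ∙-^ₛ a f zero    n = sym (*-identityˡ _)
  ∙-^ₛ a f (suc k) n = begin
    ((a ∙ f) *ₛ (a ∙ f) ^ₛ k) n       ≈⟨ *ₛ-cong {f = a ∙ f} (λ _ → refl) (∙-^ₛ a f k) n ⟩
    ((a ∙ f) *ₛ (a ^ k ∙ f ^ₛ k)) n   ≈⟨ *ₛ-∙ˡ a f (a ^ k ∙ f ^ₛ k) n ⟩
    a * (f *ₛ (a ^ k ∙ f ^ₛ k)) n     ≈⟨ *-congˡ (*ₛ-∙ʳ (a ^ k) f (f ^ₛ k) n) ⟩
    a * (a ^ k * (f ^ₛ suc k) n)      ≈⟨ *-assoc _ _ _ ⟨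
    a * a ^ k * (f ^ₛ suc k) n        ∎

  X*ₛ-suc : ∀ f n → (X *ₛ f) (suc n) ≈ f n
  X*ₛ-suc f n = begin
    (X *ₛ f) (suc n)         ≈⟨ *ₛ-sucˡ-1ₛ {X} X∘suc f n ⟩
    0# * f (suc n) + f n     ≈⟨ +-congʳ (zeroˡ _) ⟩
    0# + f n                 ≈⟨ +-identityˡ _ ⟩
    f n                      ∎
    where
    X∘suc : X ∘ suc ≈ₛ 1ₛ
    X∘suc zero    = refl
    X∘suc (suc _) = refl

  [1+X]*ₛ-suc : ∀ f n → ((1ₛ +ₛ X) *ₛ f) (suc n) ≈ f (suc n) + f n
  [1+X]*ₛ-suc f n = begin
    ((1ₛ +ₛ X) *ₛ f) (suc n)             ≈⟨ *ₛ-distribʳ-+ₛ f 1ₛ X (suc n) ⟩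
    (1ₛ *ₛ f) (suc n) + (X *ₛ f) (suc n) ≈⟨ +-cong (*ₛ-identityˡ f (suc n)) (X*ₛ-suc f n) ⟩
    f (suc n) + f n                      ∎

  -- The coefficients of `X ^ₛ k` form a Kronecker delta, so only the last term survives. Shifting
  -- `f` in the induction avoids evaluating the powers.
  Σ₀-X^ₛ : ∀ n (f : Series) → Σ[ k from 0 to n ] (f k * (X ^ₛ k) n) ≈ f n
  Σ₀-X^ₛ zero    f = trans (+-identityʳ _) (*-identityʳ (f 0))
  Σ₀-X^ₛ (suc n) f = begin
    f 0 * 0# + (Σ[ k from 0 to n ] (f (suc k) * (X *ₛ X ^ₛ k) (suc n)))
      ≈⟨ +-cong (zeroʳ (f 0)) (Σ-cong 0 n λ k → *-congˡ {f (suc k)} (X*ₛ-suc (X ^ₛ k) n)) ⟩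
    0# + (Σ[ k from 0 to n ] (f (suc k) * (X ^ₛ k) n))
      ≈⟨ trans (+-identityˡ _) (Σ₀-X^ₛ n (f ∘ suc)) ⟩
    f (suc n) ∎

  -- The series f(at). It commutes with products and powers, so the powers of log (1 + at) are
  -- dilations of those of log (1 + t).
  dilate : Carrier → Series → Series
  dilate a f n = a ^ n * f n

  ⟨∙X⟩ : ∀ a f → f ⟨ a ∙ X ⟩ ≈ₛ dilate a f
  ⟨∙X⟩ a f n = begin
    Σ[ k from 0 to n ] (f k * ((a ∙ X) ^ₛ k) n)      ≈⟨ Σ-cong 0 n (λ k →
      trans (*-congˡ {f k} (∙-^ₛ a X k n)) (trans (sym (*-assoc _ _ _)) (*-congʳ (*-comm _ _)))) ⟩
    Σ[ k from 0 to n ] (a ^ k * f k * (X ^ₛ k) n)    ≈⟨ Σ₀-X^ₛ n (dilate a f) ⟩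
    a ^ n * f n                                      ∎

  dilate-*ₛ : ∀ a f g → dilate a f *ₛ dilate a g ≈ₛ dilate a (f *ₛ g)
  dilate-*ₛ a f g n = begin
    Σ[ k from 0 to n ] (a ^ k * f k * (a ^ (n ∸ k) * g (n ∸ k)))
      ≈⟨ Σ₀-cong n (λ k k≤n →
      trans (solve 4 (λ p x q y → p :* x :* (q :* y) := p :* q :* (x :* y)) refl
               (a ^ k) (f k) (a ^ (n ∸ k)) (g (n ∸ k)))
            (*-congʳ (trans (sym (^-homo-* a k (n ∸ k))) (^-congʳ a (ℕ.m+[n∸m]≡n k≤n))))) ⟩
    Σ[ k from 0 to n ] (a ^ n * (f k * g (n ∸ k)))
      ≈⟨ *-distribˡ-Σ₀ (a ^ n) n (λ k → f k * g (n ∸ k)) ⟨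
    a ^ n * (f *ₛ g) n ∎
    where
    open Algebra.Properties.CommutativeSemiring.Exp commutativeSemiring using (^-homo-*; ^-congʳ)

  dilate-^ₛ : ∀ a f k → dilate a f ^ₛ k ≈ₛ dilate a (f ^ₛ k)
  dilate-^ₛ a f zero    zero    = sym (*-identityˡ 1#)
  dilate-^ₛ a f zero    (suc n) = sym (zeroʳ _)
  dilate-^ₛ a f (suc k) n       = trans
    (*ₛ-cong {f = dilate a f} (λ _ → refl) (dilate-^ₛ a f k) n)
    (dilate-*ₛ a f (f ^ₛ k) n)

-- The derivation t d/dt.

module EulerOperator {c ℓ} (R : CommutativeRing c ℓ) where
  open CommutativeRing R
  open RingNotation R
  open PowerSeries R
  open SumProperties R
  open SeriesProperties R
  open Algebra.Properties.Semiring.Mult semiring using (×-congˡ; ×-homo-+; ×-comm-*; ×-assoc-*)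
  private
    module S = SeriesSemiring R

  ×ₛ-coefficient : ∀ m f n → (m S.× f) n ≈ m · f n
  ×ₛ-coefficient zero    f n = const-0# n
  ×ₛ-coefficient (suc m) f n = +-congˡ (×ₛ-coefficient m f n)

  -- The derivation t d/dt.
  θ : Series → Series
  θ f n = n · f n

  -- In the term of index k, which has degrees k and n - k, the multiplier n splits as k + (n - k).
  θ-*ₛ : ∀ f g → θ (f *ₛ g) ≈ₛ θ f *ₛ g +ₛ f *ₛ θ g
  θ-*ₛ f g n = begin
    n · (f *ₛ g) n
      ≈⟨ ·-distrib-Σ₀ n n (λ k → f k * g (n ∸ k)) ⟩
    Σ[ k from 0 to n ] (n · (f k * g (n ∸ k)))
      ≈⟨ Σ₀-cong n leibniz ⟩
    Σ[ k from 0 to n ] (θ f k * g (n ∸ k) + f k * θ g (n ∸ k))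
      ≈⟨ Σ₀-distrib-+ n (λ k → θ f k * g (n ∸ k)) (λ k → f k * θ g (n ∸ k)) ⟩
    (θ f *ₛ g) n + (f *ₛ θ g) n ∎
    where
    open SetoidReasoning setoid
    leibniz : ∀ k → k ≤ n →
      n · (f k * g (n ∸ k)) ≈ θ f k * g (n ∸ k) + f k * θ g (n ∸ k)
    leibniz k k≤n = begin
      n · (f k * g (n ∸ k))
        ≈⟨ ×-congˡ (ℕ.m+[n∸m]≡n k≤n) ⟨
      (k +ℕ (n ∸ k)) · (f k * g (n ∸ k))
        ≈⟨ ×-homo-+ _ k (n ∸ k) ⟩
      k · (f k * g (n ∸ k)) + (n ∸ k) · (f k * g (n ∸ k))
        ≈⟨ +-cong (×-assoc-* k _ _) (×-comm-* (n ∸ k) _ _) ⟨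
      θ f k * g (n ∸ k) + f k * θ g (n ∸ k) ∎

  θ-^ₛ : ∀ f k → θ (f ^ₛ suc k) ≈ₛ suc k S.× (θ f *ₛ f ^ₛ k)
  θ-^ₛ f zero    = begin
    θ (f *ₛ 1ₛ)                ≈⟨ θ-*ₛ f 1ₛ ⟩
    θ f *ₛ 1ₛ +ₛ f *ₛ θ 1ₛ     ≈⟨ S.+-congˡ (S.*-congˡ {f} θ-1ₛ) ⟩
    θ f *ₛ 1ₛ +ₛ f *ₛ S.0#     ≈⟨ S.+-congˡ (S.zeroʳ f) ⟩
    1 S.× (θ f *ₛ 1ₛ)          ∎
    where
    open S.Reasoning
    θ-1ₛ : θ 1ₛ ≈ₛ S.0#
    θ-1ₛ zero    = refl
    θ-1ₛ (suc n) = trans (·-as-* (suc n) 0#) (zeroʳ _)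
  θ-^ₛ f (suc k) = begin
    θ (f *ₛ f ^ₛ suc k)
      ≈⟨ θ-*ₛ f (f ^ₛ suc k) ⟩
    θ f *ₛ f ^ₛ suc k +ₛ f *ₛ θ (f ^ₛ suc k)
      ≈⟨ S.+-congˡ (S.*-congˡ {f} (θ-^ₛ f k)) ⟩
    θ f *ₛ f ^ₛ suc k +ₛ f *ₛ (suc k S.× (θ f *ₛ f ^ₛ k))
      ≈⟨ S.+-congˡ (S.×-comm-* (suc k) f _) ⟩
    θ f *ₛ f ^ₛ suc k +ₛ suc k S.× (f *ₛ (θ f *ₛ f ^ₛ k))
      ≈⟨ S.+-congˡ (S.×-congʳ (suc k)
           (S.solve 3 (λ a b c → a S.:* (b S.:* c) S.:= b S.:* (a S.:* c)) S.refl f (θ f) (f ^ₛ k))) ⟩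
    suc (suc k) S.× (θ f *ₛ f ^ₛ suc k) ∎
    where open S.Reasoning

-- Recurrence and vanishing of the Stirling numbers of the first kind.

module StirlingRecurrence where
  open Stirling
  open PowerSeries ℤ.+-*-commutativeRing using (X; const; _-ₛ_; 1ₛ; _≈ₛ_)
  open SeriesProperties ℤ.+-*-commutativeRing

  S⁽¹⁾-suc-zero : ∀ n → S⁽¹⁾ (suc n) 0 ≡ ℤ.0ℤ
  S⁽¹⁾-suc-zero zero    = ≡.refl
  S⁽¹⁾-suc-zero (suc n) = ≡.cong (λ s → s ℤ.* (ℤ.0ℤ ℤ.- ℤ.+ suc n) ℤ.+ ℤ.0ℤ) (S⁽¹⁾-suc-zero n)

  -- This compares coefficients after multiplication by x - n; `ℤ.0ℤ ℤ.- ℤ.+ n` is the constant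
  -- coefficient of that factor as it is computed.
  S⁽¹⁾-suc-suc : ∀ n k →
    S⁽¹⁾ (suc n) (suc k) ≡ (ℤ.0ℤ ℤ.- ℤ.+ n) ℤ.* S⁽¹⁾ n (suc k) ℤ.+ S⁽¹⁾ n k
  S⁽¹⁾-suc-suc n k = ≡.trans
    (*ₛ-comm (fallingFactorial n) (X -ₛ const (ℤ.+ n)) (suc k))
    (*ₛ-sucˡ-1ₛ {X -ₛ const (ℤ.+ n)} X-n∘suc (fallingFactorial n) k)
    where
    X-n∘suc : (X -ₛ const (ℤ.+ n)) ∘ suc ≈ₛ 1ₛ
    X-n∘suc zero    = ≡.refl
    X-n∘suc (suc _) = ≡.refl

  -- With the negative term moved to the left, `fromℤ` only has to respect sums and multiples by
  -- natural numbers, and the shape is that of `log1+-^ₛ-recurrence`.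
  S⁽¹⁾-recurrence : ∀ n k → S⁽¹⁾ (suc n) (suc k) ℤ.+ S⁽¹⁾ n (suc k) ℤ.* ℤ.+ n ≡ S⁽¹⁾ n k
  S⁽¹⁾-recurrence n k = begin
    S⁽¹⁾ (suc n) (suc k) ℤ.+ s ℤ.* ℤ.+ n
      ≡⟨ ≡.cong (ℤ._+ s ℤ.* ℤ.+ n) (S⁽¹⁾-suc-suc n k) ⟩
    (ℤ.0ℤ ℤ.- ℤ.+ n) ℤ.* s ℤ.+ S⁽¹⁾ n k ℤ.+ s ℤ.* ℤ.+ n
      ≡⟨ solve 3 (λ m s t → (con ℤ.0ℤ :- m) :* s :+ t :+ s :* m := t) ≡.refl (ℤ.+ n) s (S⁽¹⁾ n k) ⟩
    S⁽¹⁾ n k ∎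
    where
    open ≡.≡-Reasoning
    open Data.Integer.Solver.+-*-Solver
    s = S⁽¹⁾ n (suc k)

  n<k⇒S⁽¹⁾≡0 : ∀ {n k} → n < k → S⁽¹⁾ n k ≡ ℤ.0ℤ
  n<k⇒S⁽¹⁾≡0 {zero}  {suc k} (s≤s _)   = ≡.refl
  n<k⇒S⁽¹⁾≡0 {suc n} {suc k} (s≤s n<k) = begin
    S⁽¹⁾ (suc n) (suc k)
      ≡⟨ S⁽¹⁾-suc-suc n k ⟩
    (ℤ.0ℤ ℤ.- ℤ.+ n) ℤ.* S⁽¹⁾ n (suc k) ℤ.+ S⁽¹⁾ n k
      ≡⟨ ≡.cong₂ (λ s t → (ℤ.0ℤ ℤ.- ℤ.+ n) ℤ.* s ℤ.+ t)
           (n<k⇒S⁽¹⁾≡0 (ℕ.m<n⇒m<1+n n<k)) (n<k⇒S⁽¹⁾≡0 n<k) ⟩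
    (ℤ.0ℤ ℤ.- ℤ.+ n) ℤ.* ℤ.0ℤ ℤ.+ ℤ.0ℤ
      ≡⟨ ≡.trans (ℤ.+-identityʳ _) (ℤ.*-zeroʳ (ℤ.0ℤ ℤ.- ℤ.+ n)) ⟩
    ℤ.0ℤ ∎
    where open ≡.≡-Reasoning

-- The canonical map from the integers to a ring.

module FromIntegers {c ℓ} (R : CommutativeRing c ℓ) where
  open CommutativeRing R
  open RingNotation R
  open Algebra.Properties.Ring ring using (-‿+-comm; -0#≈0#)
  open Algebra.Properties.Semiring.Mult semiring using (×-homo-+)
  open CommutativeSemigroupProperties
    (CommutativeMonoid.commutativeSemigroup +-commutativeMonoid)
    using (interchange)
  open SetoidReasoning setoid

  fromℤ-⊖ : ∀ m n → fromℤ (m ℤ.⊖ n) ≈ m · 1# - n · 1#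
  fromℤ-⊖ m       zero    = sym (trans (+-congˡ -0#≈0#) (+-identityʳ _))
  fromℤ-⊖ zero    (suc n) = sym (+-identityˡ _)
  fromℤ-⊖ (suc m) (suc n) = begin
    fromℤ (suc m ℤ.⊖ suc n)               ≡⟨ ≡.cong fromℤ (ℤ.[1+m]⊖[1+n]≡m⊖n m n) ⟩
    fromℤ (m ℤ.⊖ n)                       ≈⟨ fromℤ-⊖ m n ⟩
    m · 1# - n · 1#                       ≈⟨ +-identityˡ _ ⟨
    0# + (m · 1# - n · 1#)                ≈⟨ +-congʳ (-‿inverseʳ 1#) ⟨
    (1# - 1#) + (m · 1# - n · 1#)         ≈⟨ interchange _ _ _ _ ⟩
    (1# + m · 1#) + (- 1# - n · 1#)       ≈⟨ +-congˡ (-‿+-comm 1# (n · 1#)) ⟩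
    suc m · 1# - suc n · 1#               ∎

  fromℤ-homo-+ : ∀ a b → fromℤ (a ℤ.+ b) ≈ fromℤ a + fromℤ b
  fromℤ-homo-+ (ℤ.+ m)    (ℤ.+ n)    = ×-homo-+ 1# m n
  fromℤ-homo-+ (ℤ.+ m)    ℤ.-[1+ n ] = fromℤ-⊖ m (suc n)
  fromℤ-homo-+ ℤ.-[1+ m ] (ℤ.+ n)    = trans (fromℤ-⊖ n (suc m)) (+-comm _ _)
  fromℤ-homo-+ ℤ.-[1+ m ] ℤ.-[1+ n ] = begin
    - (suc (suc (m +ℕ n)) · 1#)            ≡⟨ ≡.cong (λ p → - (suc p · 1#)) (ℕ.+-suc m n) ⟨
    - ((suc m +ℕ suc n) · 1#)              ≈⟨ -‿cong (×-homo-+ 1# (suc m) (suc n)) ⟩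
    - (suc m · 1# + suc n · 1#)            ≈⟨ -‿+-comm _ _ ⟨
    - (suc m · 1#) - suc n · 1#            ∎

  fromℤ-*+ : ∀ a n → fromℤ (a ℤ.* ℤ.+ n) ≈ n · fromℤ a
  fromℤ-*+ a zero    = reflexive (≡.cong fromℤ (ℤ.*-zeroʳ a))
  fromℤ-*+ a (suc n) = begin
    fromℤ (a ℤ.* ℤ.+ suc n)        ≡⟨ ≡.cong fromℤ (ℤ.*-suc a (ℤ.+ n)) ⟩
    fromℤ (a ℤ.+ a ℤ.* ℤ.+ n)      ≈⟨ fromℤ-homo-+ a (a ℤ.* ℤ.+ n) ⟩
    fromℤ a + fromℤ (a ℤ.* ℤ.+ n)  ≈⟨ +-congˡ (fromℤ-*+ a n) ⟩
    suc n · fromℤ a                ∎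

-- Powers of the logarithm and Stirling numbers.

module ExpLogProperties {c ℓ} (R : CommutativeRing c ℓ)
  (ℕ-unit : ∀ n → .{{NonZero n}} →
            RingNotation.Unit R (RingNotation._·_ R n (CommutativeRing.1# R))) where

  open CommutativeRing R
  open RingNotation R
  open PowerSeries R
  open ExpLog R ℕ-unit
  open Stirling using (S⁽¹⁾)
  open StirlingRecurrence
  open SumProperties R
  open SeriesProperties R
  open SeriesOperations R
  open EulerOperator R
  open FromIntegers R
  open Algebra.Properties.Ring ring using (-1*x≈-x; +-cancelʳ)
  open Algebra.Properties.CommutativeMonoid.Mult +-commutativeMonoid using (×-distrib-+)
  open Algebra.Properties.Semiring.Mult semiring
    using (×-congˡ; ×-congʳ; ×-homo-1; ×-comm-*; ×-assocˡ)
  open SetoidReasoning setoid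

  private
    module S = SeriesSemiring R

  ·-swap : ∀ m n x → m · (n · x) ≈ n · (m · x)
  ·-swap m n x = begin
    m · (n · x)     ≈⟨ ×-assocˡ x m n ⟩
    (m *ℕ n) · x    ≈⟨ ×-congˡ (ℕ.*-comm m n) ⟩
    (n *ℕ m) · x    ≈⟨ ×-assocˡ x n m ⟨
    n · (m · x)     ∎

  -- The derivation cancels the denominators of `log1+` and leaves alternating signs from degree 1
  -- on. Multiplying by 1 + t adds neighbours, which cancel except in degree 1.
  [1+X]*ₛθlog1+ : (1ₛ +ₛ X) *ₛ θ log1+ ≈ₛ X
  [1+X]*ₛθlog1+ zero    = trans (+-identityʳ _) (zeroʳ _)
  [1+X]*ₛθlog1+ (suc n) = trans ([1+X]*ₛ-suc (θ log1+) n) (lemma n)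
    where
    θlog1+-suc : ∀ n → θ log1+ (suc n) ≈ (- 1#) ^ n
    θlog1+-suc n with ℕ-unit (suc n)
    ... | inv , _ , p = begin
      suc n · ((- 1#) ^ n * inv)     ≈⟨ ×-comm-* (suc n) _ _ ⟨
      (- 1#) ^ n * (suc n · inv)     ≈⟨ *-congˡ (·-as-* (suc n) inv) ⟩
      (- 1#) ^ n * (suc n · 1# * inv) ≈⟨ *-congˡ p ⟩
      (- 1#) ^ n * 1#                ≈⟨ *-identityʳ _ ⟩
      (- 1#) ^ n                     ∎
    lemma : ∀ n → θ log1+ (suc n) + θ log1+ n ≈ X (suc n)
    lemma zero    = trans (+-identityʳ _) (θlog1+-suc 0)
    lemma (suc n) = begin
      θ log1+ (suc (suc n)) + θ log1+ (suc n)   ≈⟨ +-cong (θlog1+-suc (suc n)) (θlog1+-suc n) ⟩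
      - 1# * (- 1#) ^ n + (- 1#) ^ n            ≈⟨ +-congʳ (-1*x≈-x _) ⟩
      - ((- 1#) ^ n) + (- 1#) ^ n               ≈⟨ -‿inverseˡ _ ⟩
      0#                                        ∎

  -- With L = log (1 + t), this is the coefficient of tⁿ⁺¹ in (1 + t) θ(Lᵏ⁺¹) = (k + 1) t Lᵏ, which
  -- follows from the power rule and the previous equation.
  log1+-^ₛ-recurrence : ∀ n k →
    suc n · (log1+ ^ₛ suc k) (suc n) + n · (log1+ ^ₛ suc k) n ≈ suc k · (log1+ ^ₛ k) n
  log1+-^ₛ-recurrence n k = begin
    θ (log1+ ^ₛ suc k) (suc n) + θ (log1+ ^ₛ suc k) n
      ≈⟨ [1+X]*ₛ-suc (θ (log1+ ^ₛ suc k)) n ⟨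
    ((1ₛ +ₛ X) *ₛ θ (log1+ ^ₛ suc k)) (suc n)
      ≈⟨ differential-equation (suc n) ⟩
    (suc k S.× (X *ₛ log1+ ^ₛ k)) (suc n)
      ≈⟨ ×ₛ-coefficient (suc k) (X *ₛ log1+ ^ₛ k) (suc n) ⟩
    suc k · (X *ₛ log1+ ^ₛ k) (suc n)
      ≈⟨ ×-congʳ (suc k) (X*ₛ-suc (log1+ ^ₛ k) n) ⟩
    suc k · (log1+ ^ₛ k) n ∎
    where
    differential-equation : (1ₛ +ₛ X) *ₛ θ (log1+ ^ₛ suc k) ≈ₛ suc k S.× (X *ₛ log1+ ^ₛ k)
    differential-equation = S.trans
      (S.*-congˡ {1ₛ +ₛ X} (θ-^ₛ log1+ k))
      (S.trans (S.×-comm-* (suc k) (1ₛ +ₛ X) (θ log1+ *ₛ log1+ ^ₛ k))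
      (S.×-congʳ (suc k)
      (S.trans (S.sym (S.*-assoc (1ₛ +ₛ X) (θ log1+) (log1+ ^ₛ k)))
      (S.*-congʳ {log1+ ^ₛ k} [1+X]*ₛθlog1+))))

  egf-log1+-^ₛ : ∀ n k → egfCoefficient (log1+ ^ₛ k) n ≈ (k !) · fromℤ (S⁽¹⁾ n k)
  egf-log1+-^ₛ zero    zero    = ×-congʳ 1 (sym (+-identityʳ 1#))
  egf-log1+-^ₛ zero    (suc k) = begin
    1 · (0# * (log1+ ^ₛ k) 0 + 0#)  ≈⟨ trans (×-homo-1 _) (trans (+-identityʳ _) (zeroˡ _)) ⟩
    0#                              ≈⟨ trans (·-as-* (suc k !) 0#) (zeroʳ _) ⟨
    (suc k !) · 0#                  ∎
  egf-log1+-^ₛ (suc n) zero    = begin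
    (suc n !) · 0#                  ≈⟨ trans (·-as-* (suc n !) 0#) (zeroʳ _) ⟩
    0#                              ≡⟨ ≡.cong fromℤ (S⁽¹⁾-suc-zero n) ⟨
    fromℤ (S⁽¹⁾ (suc n) 0)          ≈⟨ ×-homo-1 _ ⟨
    1 · fromℤ (S⁽¹⁾ (suc n) 0)      ∎
  -- Both recurrences determine the value at n + 1 only together with n times the value at n. By the
  -- induction hypothesis at k + 1 that extra term is the same on both sides, so it is added and
  -- then cancelled; the right-hand sides agree by the induction hypothesis at k.
  egf-log1+-^ₛ (suc n) (suc k) = +-cancelʳ (n · ((suc k !) · s)) _ _ (begin
    (suc n !) · p (suc n) + n · ((suc k !) · s)
      ≈⟨ +-cong (sym (trans (·-swap (n !) (suc n) _) (×-assocˡ _ (suc n) (n !))))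
                (trans (×-congʳ n (sym (egf-log1+-^ₛ n (suc k)))) (·-swap n (n !) (p n))) ⟩
    (n !) · (suc n · p (suc n)) + (n !) · (n · p n)
      ≈⟨ ×-distrib-+ _ _ (n !) ⟨
    (n !) · (suc n · p (suc n) + n · p n)
      ≈⟨ ×-congʳ (n !) (log1+-^ₛ-recurrence n k) ⟩
    (n !) · (suc k · (log1+ ^ₛ k) n)
      ≈⟨ ·-swap (n !) (suc k) _ ⟩
    suc k · egfCoefficient (log1+ ^ₛ k) n
      ≈⟨ ×-congʳ (suc k) (egf-log1+-^ₛ n k) ⟩
    suc k · ((k !) · fromℤ (S⁽¹⁾ n k))
      ≈⟨ ×-assocˡ _ (suc k) (k !) ⟩
    (suc k !) · fromℤ (S⁽¹⁾ n k)
      ≈⟨ ×-congʳ (suc k !) fromℤ-recurrence ⟨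
    (suc k !) · (fromℤ (S⁽¹⁾ (suc n) (suc k)) + n · s)
      ≈⟨ ×-distrib-+ _ _ (suc k !) ⟩
    (suc k !) · fromℤ (S⁽¹⁾ (suc n) (suc k)) + (suc k !) · (n · s)
      ≈⟨ +-congˡ (·-swap (suc k !) n s) ⟩
    (suc k !) · fromℤ (S⁽¹⁾ (suc n) (suc k)) + n · ((suc k !) · s) ∎)
    where
    p = log1+ ^ₛ suc k
    s = fromℤ (S⁽¹⁾ n (suc k))
    fromℤ-recurrence : fromℤ (S⁽¹⁾ (suc n) (suc k)) + n · s ≈ fromℤ (S⁽¹⁾ n k)
    fromℤ-recurrence = begin
      fromℤ (S⁽¹⁾ (suc n) (suc k)) + n · s
        ≈⟨ +-congˡ (fromℤ-*+ (S⁽¹⁾ n (suc k)) n) ⟨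
      fromℤ (S⁽¹⁾ (suc n) (suc k)) + fromℤ (S⁽¹⁾ n (suc k) ℤ.* ℤ.+ n)
        ≈⟨ fromℤ-homo-+ (S⁽¹⁾ (suc n) (suc k)) (S⁽¹⁾ n (suc k) ℤ.* ℤ.+ n) ⟨
      fromℤ (S⁽¹⁾ (suc n) (suc k) ℤ.+ S⁽¹⁾ n (suc k) ℤ.* ℤ.+ n)
        ≡⟨ ≡.cong fromℤ (S⁽¹⁾-recurrence n k) ⟩
      fromℤ (S⁽¹⁾ n k) ∎

-- Binomial convolution and Stirling expansions.

module ExponentialGeneratingFunctions {c ℓ} (R : CommutativeRing c ℓ)
  (ℕ-unit : ∀ n → .{{NonZero n}} →
            RingNotation.Unit R (RingNotation._·_ R n (CommutativeRing.1# R))) where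

  open CommutativeRing R
  open RingNotation R
  open PowerSeries R
  open ExpLog R ℕ-unit
  open Stirling using (S⁽¹⁾)
  open StirlingRecurrence
  open SumProperties R
  open SeriesProperties R
  open SeriesOperations R
  open ExpLogProperties R ℕ-unit
  open Algebra.Properties.CommutativeMonoid.Mult +-commutativeMonoid using (×-distrib-+)
  open Algebra.Properties.Semiring.Mult semiring
    using (×-congˡ; ×-congʳ; ×-comm-*; ×-assoc-*; ×-assocˡ)
  open Algebra.Properties.CommutativeSemiring.Exp commutativeSemiring
    using (^-congˡ; ^-congʳ; ^-homo-*; ^-distrib-*)
  open CommutativeSemigroupProperties
    (CommutativeMonoid.commutativeSemigroup *-commutativeMonoid)
    using (x∙yz≈y∙xz)
  open NaturalCoefficients commutativeSemiring using (solve; _:*_; _:+_; _:=_)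
  open SetoidReasoning setoid

  private
    module S = SeriesSemiring R

  -- The Euler numbers are values at x = 0, so their generating function carries a factor with
  -- exponent 0 that has to be recognised as 1.
  power1+-0 : ∀ u {a} → a ≈ 0# → power1+ u a ≈ₛ 1ₛ
  power1+-0 u {a} a≈0 zero    = power1+-constant u a
  power1+-0 u {a} a≈0 (suc n) = begin
    exp 0 * 0# + (Σ[ k from 0 to n ] (exp (suc k) * (v *ₛ v ^ₛ k) (suc n)))
      ≈⟨ +-cong (zeroʳ (exp 0)) (Σ₀-0 n λ k → trans
           (*-congˡ {exp (suc k)} (*ₛ-zeroˡ (v ^ₛ k) v≈0 (suc n)))
           (zeroʳ _)) ⟩
    0# + 0# ≈⟨ +-identityˡ 0# ⟩
    0#      ∎
    where
    v = a ∙ log1+ ⟨ u ⟩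
    v≈0 : ∀ m → v m ≈ 0#
    v≈0 m = trans (*-congʳ a≈0) (zeroˡ ((log1+ ⟨ u ⟩) m))

  exp-*-! : ∀ n x → exp n * ((n !) · x) ≈ x
  exp-*-! n x with ℕ-unit (n !) {{n ℕ.!≢0}}
  ... | inv , p , _ = begin
    1# * inv * ((n !) · x)           ≈⟨ *-cong (*-identityˡ inv) (·-as-* (n !) x) ⟩
    inv * ((n !) · 1# * x)           ≈⟨ *-assoc _ _ _ ⟨
    inv * ((n !) · 1#) * x           ≈⟨ *-congʳ p ⟩
    1# * x                           ≈⟨ *-identityˡ x ⟩
    x                                ∎

  -- The origin of the powers of λ in the theorem: dilation contributes aⁿ and the exponent z/a
  -- contributes a⁻ᵏ. For k ≤ n they combine to a power with a natural exponent.
  [z/a]^k*a^n : ∀ z {a} (u : Unit a) {n k} → k ≤ n →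
    (z / a [ u ]) ^ k * a ^ n ≈ a ^ (n ∸ k) * z ^ k
  [z/a]^k*a^n z {a} u@(a⁻¹ , a⁻¹*a≈1 , _) {n} {k} k≤n = begin
    (z * a⁻¹) ^ k * a ^ n                    ≈⟨ *-congˡ (^-congʳ a (ℕ.m∸n+n≡m k≤n)) ⟨
    (z * a⁻¹) ^ k * a ^ (n ∸ k +ℕ k)         ≈⟨ *-congˡ (^-homo-* a (n ∸ k) k) ⟩
    (z * a⁻¹) ^ k * (a ^ (n ∸ k) * a ^ k)    ≈⟨ x∙yz≈y∙xz _ _ _ ⟩
    a ^ (n ∸ k) * ((z * a⁻¹) ^ k * a ^ k)    ≈⟨ *-congˡ (^-distrib-* (z * a⁻¹) a k) ⟨
    a ^ (n ∸ k) * (z * a⁻¹ * a) ^ k          ≈⟨ *-congˡ (^-congˡ k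
      (trans (*-assoc z a⁻¹ a) (trans (*-congˡ a⁻¹*a≈1) (*-identityʳ z)))) ⟩
    a ^ (n ∸ k) * z ^ k                      ∎

  egf-cong : ∀ {f g} → f ≈ₛ g → ∀ n → egfCoefficient f n ≈ egfCoefficient g n
  egf-cong f≈g n = ×-congʳ (n !) (f≈g n)

  egf-*ₛ : ∀ f g n → egfCoefficient (f *ₛ g) n ≈
    Σ[ k from 0 to n ] ((n C k) · (egfCoefficient f k * egfCoefficient g (n ∸ k)))
  egf-*ₛ f g n = trans
    (·-distrib-Σ₀ (n !) n (λ k → f k * g (n ∸ k)))
    (Σ₀-cong n term)
    where
    term : ∀ k → k ≤ n → (n !) · (f k * g (n ∸ k)) ≈
      (n C k) · (egfCoefficient f k * egfCoefficient g (n ∸ k))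
    term k k≤n = begin
      (n !) · (f k * g (n ∸ k))
        ≈⟨ ×-congˡ (n!≡nCk*[k!*[n∸k]!] k≤n) ⟩
      ((n C k) *ℕ (k ! *ℕ (n ∸ k) !)) · (f k * g (n ∸ k))
        ≈⟨ ×-assocˡ _ (n C k) (k ! *ℕ (n ∸ k) !) ⟨
      (n C k) · ((k ! *ℕ (n ∸ k) !) · (f k * g (n ∸ k)))
        ≈⟨ ×-congʳ (n C k) (×-assocˡ _ (k !) ((n ∸ k) !)) ⟨
      (n C k) · ((k !) · (((n ∸ k) !) · (f k * g (n ∸ k))))
        ≈⟨ ×-congʳ (n C k) (×-congʳ (k !) (×-comm-* ((n ∸ k) !) _ _)) ⟨
      (n C k) · ((k !) · (f k * egfCoefficient g (n ∸ k)))
        ≈⟨ ×-congʳ (n C k) (×-assoc-* (k !) _ _) ⟨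
      (n C k) · (egfCoefficient f k * egfCoefficient g (n ∸ k)) ∎

  -- The sequence is kept apart from egfCoefficient f so that a sum over it, once instantiated
  -- over ℂ, is compared without unfolding the series.
  IsEgf : (ℕ → Carrier) → Series → Set c
  IsEgf E f = ∀ n → E n ≡ egfCoefficient f n

  -- Inserting `e`, which equals 1, after `b` produces the product that defines the sequence `A`;
  -- the remaining factor is `f *ₛ g`.
  isEgf-*ₛ-*ₛ : ∀ {b e f g A G H} → e ≈ₛ 1ₛ → IsEgf A (b *ₛ e) → IsEgf G (f *ₛ g) →
    IsEgf H (b *ₛ f *ₛ g) → ∀ n → H n ≈ Σ[ k from 0 to n ] ((n C k) · (A k * G (n ∸ k)))
  isEgf-*ₛ-*ₛ {b} {e} {f} {g} {A} {G} {H} e≈1 A-egf G-egf H-egf n = begin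
    H n
      ≡⟨ H-egf n ⟩
    egfCoefficient (b *ₛ f *ₛ g) n
      ≈⟨ egf-cong (S.trans (S.*-assoc b f g) (S.*-congʳ {f *ₛ g} (S.sym b*ₛe≈b))) n ⟩
    egfCoefficient (b *ₛ e *ₛ (f *ₛ g)) n
      ≈⟨ egf-*ₛ (b *ₛ e) (f *ₛ g) n ⟩
    Σ[ k from 0 to n ] ((n C k) · (egfCoefficient (b *ₛ e) k * egfCoefficient (f *ₛ g) (n ∸ k)))
      ≈⟨ Σ-cong 0 n (λ k → reflexive
           (≡.cong₂ (λ p q → (n C k) · (p * q)) (A-egf k) (G-egf (n ∸ k)))) ⟨
    Σ[ k from 0 to n ] ((n C k) · (A k * G (n ∸ k))) ∎
    where
    b*ₛe≈b : b *ₛ e ≈ₛ b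
    b*ₛe≈b = S.trans (S.*-congˡ {b} e≈1) (S.*-identityʳ b)

  -- The coefficientwise form of g = Σ cₖ (log (1 + a t) / a)ᵏ / k!, where a need not be a unit.
  record StirlingExpansion (a : Carrier) (c : ℕ → Carrier) (g : Series) : Set ℓ where
    constructor expansion
    field
      egf≈ : ∀ n →
        egfCoefficient g n ≈ Σ[ k from 0 to n ] (a ^ (n ∸ k) * c k * fromℤ (S⁽¹⁾ n k))

  stirlingExpansion-resp-≈ₛ : ∀ {a c f g} → f ≈ₛ g →
    StirlingExpansion a c f → StirlingExpansion a c g
  stirlingExpansion-resp-≈ₛ f≈g (expansion egf-f) =
    expansion λ n → trans (egf-cong (λ m → sym (f≈g m)) n) (egf-f n)

  -- Term by term: `exp k` cancels the k! that `egf-log1+-^ₛ` attaches to the Stirling number, and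
  -- the powers of `a` combine by `[z/a]^k*a^n`.
  egf-power1+ : ∀ z {a} (u : Unit a) →
    StirlingExpansion a (z ^_) (power1+ (a ∙ X) (z / a [ u ]))
  egf-power1+ z {a} u = expansion λ n → trans
    (·-distrib-Σ₀ (n !) n (λ k → exp k * ((b ∙ log1+ ⟨ a ∙ X ⟩) ^ₛ k) n))
    (Σ₀-cong n (term n))
    where
    b = z / a [ u ]
    term : ∀ n k → k ≤ n →
      (n !) · (exp k * ((b ∙ log1+ ⟨ a ∙ X ⟩) ^ₛ k) n) ≈ a ^ (n ∸ k) * z ^ k * fromℤ (S⁽¹⁾ n k)
    term n k k≤n = begin
      (n !) · (exp k * ((b ∙ log1+ ⟨ a ∙ X ⟩) ^ₛ k) n)
        ≈⟨ ×-congʳ (n !) (*-congˡ log-^ₛ) ⟩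
      (n !) · (exp k * (b ^ k * a ^ n * (log1+ ^ₛ k) n))
        ≈⟨ trans (*-congˡ (×-comm-* (n !) _ _)) (×-comm-* (n !) _ _) ⟨
      exp k * (b ^ k * a ^ n * egfCoefficient (log1+ ^ₛ k) n)
        ≈⟨ *-congˡ (*-congˡ (egf-log1+-^ₛ n k)) ⟩
      exp k * (b ^ k * a ^ n * ((k !) · s))
        ≈⟨ x∙yz≈y∙xz _ _ _ ⟩
      b ^ k * a ^ n * (exp k * ((k !) · s))
        ≈⟨ *-cong ([z/a]^k*a^n z u k≤n) (exp-*-! k s) ⟩
      a ^ (n ∸ k) * z ^ k * s ∎
      where
      s = fromℤ (S⁽¹⁾ n k)
      log-^ₛ : ((b ∙ log1+ ⟨ a ∙ X ⟩) ^ₛ k) n ≈ b ^ k * a ^ n * (log1+ ^ₛ k) n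
      log-^ₛ = begin
        ((b ∙ log1+ ⟨ a ∙ X ⟩) ^ₛ k) n      ≈⟨ ∙-^ₛ b (log1+ ⟨ a ∙ X ⟩) k n ⟩
        b ^ k * ((log1+ ⟨ a ∙ X ⟩) ^ₛ k) n  ≈⟨ *-congˡ (S.^-congˡ k (⟨∙X⟩ a log1+) n) ⟩
        b ^ k * (dilate a log1+ ^ₛ k) n     ≈⟨ *-congˡ (dilate-^ₛ a log1+ k n) ⟩
        b ^ k * (a ^ n * (log1+ ^ₛ k) n)    ≈⟨ *-assoc _ _ _ ⟨
        b ^ k * a ^ n * (log1+ ^ₛ k) n      ∎

  -- The sum over the triangle k ≤ l is first filled up to the square with sides from 0 to n, where
  -- the order of summation can be exchanged, and then cut back to l ≥ k. Both changes are harmless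
  -- because S⁽¹⁾(l, k) vanishes for l < k, which also covers the truncated exponent `l ∸ k` there.
  isEgf-*ₛ-stirling : ∀ {a c f g F H} → StirlingExpansion a c g → IsEgf F f →
    IsEgf H (f *ₛ g) → ∀ n → H n ≈
      Σ[ k from 0 to n ] (Σ[ l from k to n ]
        ((n C l) · (a ^ (l ∸ k) * c k * fromℤ (S⁽¹⁾ l k) * F (n ∸ l))))
  isEgf-*ₛ-stirling {a} {c} {f} {g} {F} {H} (expansion egf-g) F-egf H-egf n = begin
    H n
      ≡⟨ H-egf n ⟩
    egfCoefficient (f *ₛ g) n
      -- With `g` on the left, the index l is the degree taken from the factor with the Stirling
      -- expansion.
      ≈⟨ egf-cong (*ₛ-comm f g) n ⟩
    egfCoefficient (g *ₛ f) n
      ≈⟨ egf-*ₛ g f n ⟩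
    Σ[ l from 0 to n ] ((n C l) · (egfCoefficient g l * egfCoefficient f (n ∸ l)))
      ≈⟨ Σ-cong 0 n (λ l → reflexive
           (≡.cong (λ p → (n C l) · (egfCoefficient g l * p)) (F-egf (n ∸ l)))) ⟨
    Σ[ l from 0 to n ] ((n C l) · (egfCoefficient g l * F (n ∸ l)))
      ≈⟨ Σ₀-cong n expand ⟩
    Σ[ l from 0 to n ] (Σ[ k from 0 to n ] T k l)
      ≈⟨ Σ₀-comm n n (λ l k → T k l) ⟩
    Σ[ k from 0 to n ] (Σ[ l from 0 to n ] T k l)
      ≈⟨ Σ-cong 0 n (λ k → Σ₀-drop k n (T k) λ l l<k →
           trans (×-congʳ (n C l) (trans (*-congʳ (t-zero l<k)) (zeroˡ _)))
                 (trans (·-as-* (n C l) 0#) (zeroʳ _))) ⟩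
    Σ[ k from 0 to n ] (Σ[ l from k to n ] T k l) ∎
    where
    t T : ℕ → ℕ → Carrier
    t k l = a ^ (l ∸ k) * c k * fromℤ (S⁽¹⁾ l k)
    T k l = (n C l) · (t k l * F (n ∸ l))
    t-zero : ∀ {k l} → l < k → t k l ≈ 0#
    t-zero l<k = trans (*-congˡ (reflexive (≡.cong fromℤ (n<k⇒S⁽¹⁾≡0 l<k)))) (zeroʳ _)
    expand : ∀ l → l ≤ n →
      (n C l) · (egfCoefficient g l * F (n ∸ l)) ≈ Σ[ k from 0 to n ] T k l
    expand l l≤n = begin
      (n C l) · (egfCoefficient g l * F (n ∸ l))
        ≈⟨ ×-congʳ (n C l) (*-congʳ (trans (egf-g l)
             (Σ₀-extend (λ k → t k l) l≤n (λ k → t-zero)))) ⟩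
      (n C l) · (sumFromTo 0 n (λ k → t k l) * F (n ∸ l))
        ≈⟨ ×-congʳ (n C l) (*-distribʳ-Σ₀ _ n (λ k → t k l)) ⟩
      (n C l) · (Σ[ k from 0 to n ] (t k l * F (n ∸ l)))
        ≈⟨ ·-distrib-Σ₀ (n C l) n (λ k → t k l * F (n ∸ l)) ⟩
      Σ[ k from 0 to n ] T k l ∎

  -- One statement for both functions: r = 1, s = 1/2 gives the cosine and r = -1, s = 1/(2i) the
  -- sine.
  stirlingExpansion-linear : ∀ {a c d f g} r s →
    StirlingExpansion a c f → StirlingExpansion a d g →
    StirlingExpansion a (λ k → (c k + r * d k) * s) (λ n → (f n + r * g n) * s)
  stirlingExpansion-linear {a} {c} {d} {f} {g} r s (expansion egf-f) (expansion egf-g) =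
    expansion λ n → let term = term n in begin
    (n !) · ((f n + r * g n) * s)
      ≈⟨ ×-assoc-* (n !) _ s ⟨
    (n !) · (f n + r * g n) * s
      ≈⟨ *-congʳ (trans (×-distrib-+ _ _ (n !)) (+-congˡ (sym (×-comm-* (n !) r (g n))))) ⟩
    (egfCoefficient f n + r * egfCoefficient g n) * s
      ≈⟨ *-congʳ (+-cong (egf-f n) (*-congˡ (egf-g n))) ⟩
    (sumFromTo 0 n (term c) + r * sumFromTo 0 n (term d)) * s
      ≈⟨ *-congʳ (+-congˡ (*-distribˡ-Σ₀ r n (term d))) ⟩
    (sumFromTo 0 n (term c) + (Σ[ k from 0 to n ] (r * term d k))) * s
      ≈⟨ *-congʳ (Σ₀-distrib-+ n (term c) (λ k → r * term d k)) ⟨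
    sumFromTo 0 n (λ k → term c k + r * term d k) * s
      ≈⟨ *-distribʳ-Σ₀ s n (λ k → term c k + r * term d k) ⟩
    Σ[ k from 0 to n ] ((term c k + r * term d k) * s)
      ≈⟨ Σ-cong 0 n (λ k →
           solve 6 (λ a c d r s t →
             (a :* c :* t :+ r :* (a :* d :* t)) :* s := a :* ((c :+ r :* d) :* s) :* t) refl
             (a ^ (n ∸ k)) (c k) (d k) r s (fromℤ (S⁽¹⁾ n k))) ⟩
    Σ[ k from 0 to n ] (a ^ (n ∸ k) * ((c k + r * d k) * s) * fromℤ (S⁽¹⁾ n k)) ∎
    where
    term : ℕ → (ℕ → Carrier) → ℕ → Carrier
    term n c k = a ^ (n ∸ k) * c k * fromℤ (S⁽¹⁾ n k)

-- The degenerate exponential.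

module DegenerateExponential {c ℓ} (R : CommutativeRing c ℓ)
  (ℕ-unit : ∀ n → .{{NonZero n}} →
            RingNotation.Unit R (RingNotation._·_ R n (CommutativeRing.1# R)))
  {a} (u : RingNotation.Unit R a) where

  open CommutativeRing R
  open RingNotation R
  open PowerSeries R
  open ExpLog R ℕ-unit
  open ExponentialGeneratingFunctions R ℕ-unit

  e^ : Carrier → Series
  e^ z = power1+ (a ∙ X) (z / a [ u ])

  -- The series is a variable tied to `e^ z` by an equation, so that a caller can keep its own
  -- spelling of the same series.
  e^-expansion : ∀ {e} z → e ≡ e^ z → StirlingExpansion a (z ^_) e
  e^-expansion z ≡.refl = egf-power1+ z u

  e^0≈1 : ∀ {e z} → e ≡ e^ z → z ≈ 0# → e ≈ₛ 1ₛ
  e^0≈1 ≡.refl z≈0 = power1+-0 (a ∙ X) (trans (*-congʳ z≈0) (zeroˡ (proj₁ u)))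

-- Cosine and sine from a square root of -1.

module Trigonometric {c ℓ} (R : CommutativeRing c ℓ)
  (ℕ-unit : ∀ n → .{{NonZero n}} →
            RingNotation.Unit R (RingNotation._·_ R n (CommutativeRing.1# R)))
  {ι} (ι-unit : RingNotation.Unit R ι)
  (ι*ι≈-1 : CommutativeRing._≈_ R (CommutativeRing._*_ R ι ι)
              (CommutativeRing.-_ R (CommutativeRing.1# R))) where

  open CommutativeRing R
  open RingNotation R
  open PowerSeries R
  open Stirling using (S⁽¹⁾)
  open SumProperties R
  open ExponentialGeneratingFunctions R ℕ-unit
  open Algebra.Properties.Ring ring
    using (-1*x≈-x; -‿distribˡ-*; -‿distribʳ-*; -‿involutive)
  open Algebra.Properties.Semiring.Mult semiring using (×-congʳ)
  open Algebra.Properties.CommutativeSemiring.Exp commutativeSemiring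
    using (^-congˡ; ^-assocʳ; ^-distrib-*)
  open NaturalCoefficients commutativeSemiring using (solve; _:*_; _:=_)
  open SetoidReasoning setoid

  2⁻¹ [2ι]⁻¹ : Carrier
  2⁻¹    = proj₁ (ℕ-unit 2)
  [2ι]⁻¹ = proj₁ (unit-* (ℕ-unit 2) ι-unit)

  -- The weights c of the two Stirling expansions. The factors `1#` and `- 1#` stay unsimplified so
  -- that the weights are literally those produced by `stirlingExpansion-linear`.
  cosPower sinPower : Carrier → ℕ → Carrier
  cosPower y k = ((ι * y) ^ k + 1# * (- (ι * y)) ^ k) * 2⁻¹
  sinPower y k = ((ι * y) ^ k + - 1# * (- (ι * y)) ^ k) * [2ι]⁻¹

  module _ {a y e⁺ e⁻} (e⁺-expansion : StirlingExpansion a ((ι * y) ^_) e⁺)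
    (e⁻-expansion : StirlingExpansion a ((- (ι * y)) ^_) e⁻) where

    cos-expansion :
      StirlingExpansion a (cosPower y) (λ n → (e⁺ n + e⁻ n) / 2# [ ℕ-unit 2 ])
    cos-expansion = stirlingExpansion-resp-≈ₛ
      (λ m → *-congʳ (+-congˡ (*-identityˡ _)))
      (stirlingExpansion-linear 1# 2⁻¹ e⁺-expansion e⁻-expansion)

    sin-expansion :
      StirlingExpansion a (sinPower y) (λ n → (e⁺ n - e⁻ n) / 2# * ι [ unit-* (ℕ-unit 2) ι-unit ])
    sin-expansion = stirlingExpansion-resp-≈ₛ
      (λ m → *-congʳ (+-congˡ (-1*x≈-x _)))
      (stirlingExpansion-linear (- 1#) [2ι]⁻¹ e⁺-expansion e⁻-expansion)

  x+x≈2x : ∀ x → x + x ≈ 2# * x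
  x+x≈2x x = trans (+-congˡ (sym (+-identityʳ x))) (·-as-* 2 x)

  -- An even power depends only on the square, so stating this for any w with w² = -y² serves iy and
  -- -iy alike.
  evenPower : ∀ {w y} → w ^ 2 ≈ - 1# * y ^ 2 → ∀ k → w ^ (2 *ℕ k) ≈ (- 1#) ^ k * y ^ (2 *ℕ k)
  evenPower {w} {y} w²≈-y² k = begin
    w ^ (2 *ℕ k)                ≈⟨ ^-assocʳ w 2 k ⟨
    (w ^ 2) ^ k                 ≈⟨ ^-congˡ k w²≈-y² ⟩
    (- 1# * y ^ 2) ^ k          ≈⟨ ^-distrib-* (- 1#) (y ^ 2) k ⟩
    (- 1#) ^ k * (y ^ 2) ^ k    ≈⟨ *-congˡ (^-assocʳ y 2 k) ⟩
    (- 1#) ^ k * y ^ (2 *ℕ k)   ∎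

  [ιy]² : ∀ y → (ι * y) ^ 2 ≈ - 1# * y ^ 2
  [ιy]² y = trans
    (solve 3 (λ i y e → i :* y :* (i :* y :* e) := i :* i :* (y :* (y :* e))) refl ι y 1#)
    (*-congʳ ι*ι≈-1)

  [-w]² : ∀ w → (- w) ^ 2 ≈ w ^ 2
  [-w]² w = begin
    - w * (- w * 1#)     ≈⟨ *-congˡ (-‿distribˡ-* w 1#) ⟨
    - w * - (w * 1#)     ≈⟨ -‿distribˡ-* w _ ⟨
    - (w * - (w * 1#))   ≈⟨ -‿cong (-‿distribʳ-* w _) ⟨
    - - (w * (w * 1#))   ≈⟨ -‿involutive _ ⟩
    w * (w * 1#)         ∎

  module _ (y : Carrier) (k : ℕ) where
    private
      w = ι * y
      p = (- 1#) ^ k * y ^ (2 *ℕ k)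

      w^2k : w ^ (2 *ℕ k) ≈ p
      w^2k = evenPower ([ιy]² y) k

      [-w]^2k : (- w) ^ (2 *ℕ k) ≈ p
      [-w]^2k = evenPower (trans ([-w]² w) ([ιy]² y)) k

    cosPower-even : cosPower y (2 *ℕ k) ≈ p
    cosPower-even = begin
      (w ^ (2 *ℕ k) + 1# * (- w) ^ (2 *ℕ k)) * 2⁻¹
        ≈⟨ *-congʳ (+-cong w^2k (trans (*-identityˡ _) [-w]^2k)) ⟩
      (p + p) * 2⁻¹
        ≈⟨ trans (*-congʳ (trans (x+x≈2x p) (*-comm 2# p))) (*-assoc p 2# 2⁻¹) ⟩
      p * (2# * 2⁻¹)
        ≈⟨ *-congˡ (proj₂ (proj₂ (ℕ-unit 2))) ⟩
      p * 1#
        ≈⟨ *-identityʳ p ⟩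
      p ∎

    cosPower-odd : cosPower y (suc (2 *ℕ k)) ≈ 0#
    cosPower-odd = begin
      (w * w ^ (2 *ℕ k) + 1# * (- w * (- w) ^ (2 *ℕ k))) * 2⁻¹
        ≈⟨ *-congʳ (+-cong (*-congˡ w^2k) (trans (*-identityˡ _) (*-congˡ [-w]^2k))) ⟩
      (w * p + - w * p) * 2⁻¹
        ≈⟨ *-congʳ (distribʳ p w (- w)) ⟨
      (w - w) * p * 2⁻¹
        ≈⟨ *-congʳ (*-congʳ (-‿inverseʳ w)) ⟩
      0# * p * 2⁻¹
        ≈⟨ trans (*-congʳ (zeroˡ p)) (zeroˡ 2⁻¹) ⟩
      0# ∎

    sinPower-even : sinPower y (2 *ℕ k) ≈ 0#
    sinPower-even = begin
      (w ^ (2 *ℕ k) + - 1# * (- w) ^ (2 *ℕ k)) * [2ι]⁻¹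
        ≈⟨ *-congʳ (+-cong w^2k (trans (-1*x≈-x _) (-‿cong [-w]^2k))) ⟩
      (p - p) * [2ι]⁻¹
        ≈⟨ trans (*-congʳ (-‿inverseʳ p)) (zeroˡ _) ⟩
      0# ∎

    sinPower-odd : sinPower y (suc (2 *ℕ k)) ≈ (- 1#) ^ k * y ^ suc (2 *ℕ k)
    sinPower-odd = begin
      (w * w ^ (2 *ℕ k) + - 1# * (- w * (- w) ^ (2 *ℕ k))) * [2ι]⁻¹
        ≈⟨ *-congʳ (+-cong (*-congˡ w^2k) (trans (-1*x≈-x _) (trans
             (-‿cong (sym (-‿distribˡ-* w _))) (trans (-‿involutive _) (*-congˡ [-w]^2k))))) ⟩
      (w * p + w * p) * [2ι]⁻¹
        ≈⟨ *-congʳ (x+x≈2x (w * p)) ⟩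
      2# * (w * p) * [2ι]⁻¹
        ≈⟨ solve 6 (λ t i y s q h →
             -- Collecting 2, ι and the inverse of 2ι lets them cancel, and the remaining factor `y`
             -- raises the even power to the odd one.
             t :* (i :* y :* (s :* q)) :* h := s :* (y :* q) :* (t :* i :* h))
             refl 2# ι y ((- 1#) ^ k) (y ^ (2 *ℕ k)) [2ι]⁻¹ ⟩
      (- 1#) ^ k * (y * y ^ (2 *ℕ k)) * (2# * ι * [2ι]⁻¹)
        ≈⟨ trans (*-congˡ (proj₂ (proj₂ (unit-* (ℕ-unit 2) ι-unit)))) (*-identityʳ _) ⟩
      (- 1#) ^ k * y ^ suc (2 *ℕ k) ∎

  private
    regroup : ∀ m p s f {c q r} → c ≈ q * r →
      m · (p * c * s * f) ≈ m · (p * q * r * s * f)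
    regroup m p s f c≈q*r =
      ×-congʳ m (*-congʳ (*-congʳ (trans (*-congˡ c≈q*r) (sym (*-assoc _ _ _)))))

    vanish : ∀ m p s f {c} → c ≈ 0# → m · (p * c * s * f) ≈ 0#
    vanish m p s f c≈0 = trans (·-as-* m _) (trans (*-congˡ (trans (*-congʳ
      (trans (*-congʳ (trans (*-congˡ c≈0) (zeroʳ _))) (zeroˡ _))) (zeroˡ f))) (zeroʳ _))

    Σ-0 : ∀ b n {f} → (∀ k → f k ≈ 0#) → sumFromTo b n f ≈ 0#
    Σ-0 b n {f} f≈0 = trans (sym (Σ₀-drop b n f λ k _ → f≈0 k)) (Σ₀-0 n f≈0)

  isEgf-*ₛ-cos : ∀ {a y f g F H} → StirlingExpansion a (cosPower y) g → IsEgf F f →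
    IsEgf H (f *ₛ g) → ∀ n → H n ≈
    Σ[ k from 0 to ⌊ n /2⌋ ] (Σ[ l from 2 *ℕ k to n ]
      ((n C l) · (a ^ (l ∸ 2 *ℕ k) * (- 1#) ^ k * y ^ (2 *ℕ k)
                   * fromℤ (S⁽¹⁾ l (2 *ℕ k)) * F (n ∸ l))))
  isEgf-*ₛ-cos {a} {y} {f} {g} {F} {H} g-expansion F-egf H-egf n = begin
    H n
      ≈⟨ isEgf-*ₛ-stirling g-expansion F-egf H-egf n ⟩
    Σ[ k from 0 to n ] (Σ[ l from k to n ] T k l)
      ≈⟨ Σ₀-even n (λ k → Σ[ l from k to n ] T k l) (λ k → Σ-0 (suc (2 *ℕ k)) n
           λ l → vanish (n C l) (a ^ (l ∸ (suc (2 *ℕ k)))) (fromℤ (S⁽¹⁾ l (suc (2 *ℕ k))))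
             (F (n ∸ l)) (cosPower-odd y k)) ⟩
    Σ[ k from 0 to ⌊ n /2⌋ ] (Σ[ l from 2 *ℕ k to n ] T (2 *ℕ k) l)
      ≈⟨ Σ-cong 0 ⌊ n /2⌋ (λ k → Σ-cong (2 *ℕ k) n λ l →
           regroup (n C l) (a ^ (l ∸ (2 *ℕ k))) (fromℤ (S⁽¹⁾ l (2 *ℕ k)))
             (F (n ∸ l)) (cosPower-even y k)) ⟩
    Σ[ k from 0 to ⌊ n /2⌋ ] (Σ[ l from 2 *ℕ k to n ]
      ((n C l) · (a ^ (l ∸ 2 *ℕ k) * (- 1#) ^ k * y ^ (2 *ℕ k)
                   * fromℤ (S⁽¹⁾ l (2 *ℕ k)) * F (n ∸ l)))) ∎
    where
    T : ℕ → ℕ → Carrier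
    T k l = (n C l) · (a ^ (l ∸ k) * cosPower y k * fromℤ (S⁽¹⁾ l k) * F (n ∸ l))

  isEgf-*ₛ-sin : ∀ {a y f g F H} → StirlingExpansion a (sinPower y) g → IsEgf F f →
    IsEgf H (f *ₛ g) → ∀ n → 1 ≤ n → H n ≈
    Σ[ k from 0 to ⌊ n ∸ 1 /2⌋ ] (Σ[ l from 2 *ℕ k +ℕ 1 to n ]
      ((n C l) · (a ^ (l ∸ 2 *ℕ k ∸ 1) * (- 1#) ^ k * y ^ (2 *ℕ k +ℕ 1)
                   * fromℤ (S⁽¹⁾ l (2 *ℕ k +ℕ 1)) * F (n ∸ l))))
  isEgf-*ₛ-sin {a} {y} {f} {g} {F} {H} g-expansion F-egf H-egf n 1≤n = begin
    H n
      ≈⟨ isEgf-*ₛ-stirling g-expansion F-egf H-egf n ⟩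
    Σ[ k from 0 to n ] (Σ[ l from k to n ] T k l)
      ≈⟨ Σ₀-odd n (λ k → Σ[ l from k to n ] T k l) 1≤n (λ k → Σ-0 (2 *ℕ k) n
           λ l → vanish (n C l) (a ^ (l ∸ (2 *ℕ k))) (fromℤ (S⁽¹⁾ l (2 *ℕ k)))
             (F (n ∸ l)) (sinPower-even y k)) ⟩
    Σ[ k from 0 to ⌊ n ∸ 1 /2⌋ ] (Σ[ l from suc (2 *ℕ k) to n ] T (suc (2 *ℕ k)) l)
      ≈⟨ Σ-cong 0 ⌊ n ∸ 1 /2⌋ (λ k → trans
           (Σ-cong (suc (2 *ℕ k)) n λ l →
             regroup (n C l) (a ^ (l ∸ (suc (2 *ℕ k)))) (fromℤ (S⁽¹⁾ l (suc (2 *ℕ k))))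
             (F (n ∸ l)) (sinPower-odd y k))
           -- The lower bound, the power of `y` and the Stirling index all contain `suc (2 *ℕ k)`,
           -- so they are changed to `2 *ℕ k +ℕ 1` at once through `j`. The exponent of `a` is then
           -- brought separately to the form `l ∸ 2 *ℕ k ∸ 1`.
           (reflexive (≡.cong (λ j → Σ[ l from j to n ] U k l j) (ℕ.+-comm 1 (2 *ℕ k))))) ⟩
    Σ[ k from 0 to ⌊ n ∸ 1 /2⌋ ] (Σ[ l from 2 *ℕ k +ℕ 1 to n ] U k l (2 *ℕ k +ℕ 1))
      ≈⟨ Σ-cong 0 ⌊ n ∸ 1 /2⌋ (λ k → Σ-cong (2 *ℕ k +ℕ 1) n λ l →
           reflexive (≡.cong (λ e → V k l (2 *ℕ k +ℕ 1) e) (≡.sym (ℕ.∸-+-assoc l (2 *ℕ k) 1)))) ⟩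
    Σ[ k from 0 to ⌊ n ∸ 1 /2⌋ ] (Σ[ l from 2 *ℕ k +ℕ 1 to n ]
      V k l (2 *ℕ k +ℕ 1) (l ∸ 2 *ℕ k ∸ 1)) ∎
    where
    T : ℕ → ℕ → Carrier
    T k l = (n C l) · (a ^ (l ∸ k) * sinPower y k * fromℤ (S⁽¹⁾ l k) * F (n ∸ l))
    V : ℕ → ℕ → ℕ → ℕ → Carrier
    V k l j e = (n C l) ·
      (a ^ e * (- 1#) ^ k * y ^ j * fromℤ (S⁽¹⁾ l j) * F (n ∸ l))
    U : ℕ → ℕ → ℕ → Carrier
    U k l j = V k l j (l ∸ j)

  -- The cosine half with variable series: `b` stands for 2/(e_λ(t) + 1), `e` for the exponential at
  -- 0, `f` for the one at x, and `g` for the cosine. The sequences `A`, `F`, `G`, `H` become `𝓔₀`,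
  -- `𝓔` at x, `𝓒` and `𝓔⁽ᶜ⁾`.
  convolution-cos : ∀ {a y b e f g A F G H} → e ≈ₛ 1ₛ → StirlingExpansion a (cosPower y) g →
    IsEgf A (b *ₛ e) → IsEgf F (b *ₛ f) → IsEgf G (f *ₛ g) → IsEgf H (b *ₛ f *ₛ g) →
    (n : ℕ) →
    (H n ≈ Σ[ k from 0 to n ] ((n C k) · (A k * G (n ∸ k)))) ×
    (Σ[ k from 0 to n ] ((n C k) · (A k * G (n ∸ k)))
      ≈ Σ[ k from 0 to ⌊ n /2⌋ ] (Σ[ l from 2 *ℕ k to n ]
          ((n C l) · (a ^ (l ∸ 2 *ℕ k) * (- 1#) ^ k * y ^ (2 *ℕ k)
                       * fromℤ (S⁽¹⁾ l (2 *ℕ k)) * F (n ∸ l)))))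
  convolution-cos {b = b} {e} {f} {g} e≈1 g-expansion A-egf F-egf G-egf H-egf n =
    convolution ,
    -- Both sums are expansions of `H n`, so the second equality goes back through it.
    trans (sym convolution) (isEgf-*ₛ-cos {f = b *ₛ f} {g} g-expansion F-egf H-egf n)
    where convolution = isEgf-*ₛ-*ₛ {b} {e} {f} {g} e≈1 A-egf G-egf H-egf n

  convolution-sin : ∀ {a y b e f g A F G H} → e ≈ₛ 1ₛ → StirlingExpansion a (sinPower y) g →
    IsEgf A (b *ₛ e) → IsEgf F (b *ₛ f) → IsEgf G (f *ₛ g) → IsEgf H (b *ₛ f *ₛ g) →
    (n : ℕ) → 1 ≤ n →
    (H n ≈ Σ[ k from 0 to n ] ((n C k) · (A k * G (n ∸ k)))) ×
    (Σ[ k from 0 to n ] ((n C k) · (A k * G (n ∸ k)))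
      ≈ Σ[ k from 0 to ⌊ n ∸ 1 /2⌋ ] (Σ[ l from 2 *ℕ k +ℕ 1 to n ]
          ((n C l) · (a ^ (l ∸ 2 *ℕ k ∸ 1) * (- 1#) ^ k * y ^ (2 *ℕ k +ℕ 1)
                       * fromℤ (S⁽¹⁾ l (2 *ℕ k +ℕ 1)) * F (n ∸ l)))))
  convolution-sin {b = b} {e} {f} {g} e≈1 g-expansion A-egf F-egf G-egf H-egf n 1≤n =
    convolution ,
    trans (sym convolution) (isEgf-*ₛ-sin {f = b *ₛ f} {g} g-expansion F-egf H-egf n 1≤n)
    where convolution = isEgf-*ₛ-*ₛ {b} {e} {f} {g} e≈1 A-egf G-egf H-egf n

-- Specialisation to the complex numbers.

i*i≈-1 : ∀ {c ℓ} (R : CommutativeRing c ℓ) → let open Complex R in (i * i) ≈ (- 1#)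
i*i≈-1 R =
  trans (+-cong (zeroˡ _) (-‿cong (*-identityˡ _))) (+-identityˡ _) ,
  trans (+-cong (zeroˡ _) (zeroʳ _)) (trans (+-identityˡ _) (sym -0#≈0#))
  where
  open CommutativeRing R
  open Algebra.Properties.Ring ring using (-0#≈0#)

-- Over ℂ, whose elements are pairs with η, power series are compared quickly only if they
-- agree syntactically.  A name obtained by opening an instantiated module is not
-- syntactically equal to the original it stands for, so below the originals are written out;
-- in particular 0 is the field of HeytingField and not RealNumbers.0#.
module DegenerateExpansions {c ℓ₁ ℓ₂} (ℝ : RealNumbers c ℓ₁ ℓ₂)
  (lam : RealNumbers.Carrier ℝ)
  (lam#0 : RealNumbers._#_ ℝ lam (RealNumbers.0# ℝ)) where

  open CommutativeRing (Complex.commutativeRing (RealNumbers.commutativeRing ℝ))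
    using (-_; _*_; _≈_; 0#)
  open RingNotation (Complex.commutativeRing (RealNumbers.commutativeRing ℝ)) using (_^_)
  open PowerSeries (Complex.commutativeRing (RealNumbers.commutativeRing ℝ)) using (1ₛ; _≈ₛ_)
  open Trigonometric
    (Complex.commutativeRing (RealNumbers.commutativeRing ℝ)) (ComplexNumbers.ℕ-unit ℝ)
    {Complex.i (RealNumbers.commutativeRing ℝ)} (Complex.i-unit (RealNumbers.commutativeRing ℝ))
    (i*i≈-1 (RealNumbers.commutativeRing ℝ))

  -- The two spellings of e_λ^z(t) are identified here once, for a variable z; the next two lemmas
  -- pass through this equation.
  e^≡ : ∀ z → Degenerate.e^ ℝ lam lam#0 z ≡
    DegenerateExponential.e^
      (Complex.commutativeRing (RealNumbers.commutativeRing ℝ)) (ComplexNumbers.ℕ-unit ℝ)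
      {Complex.ofReal (RealNumbers.commutativeRing ℝ) lam} (Degenerate.lam-unit ℝ lam lam#0) z
  e^≡ z = ≡.refl

  e^-expansion : ∀ z →
    ExponentialGeneratingFunctions.StirlingExpansion
      (Complex.commutativeRing (RealNumbers.commutativeRing ℝ)) (ComplexNumbers.ℕ-unit ℝ)
      (Complex.ofReal (RealNumbers.commutativeRing ℝ) lam) (z ^_) (Degenerate.e^ ℝ lam lam#0 z)
  e^-expansion z = DegenerateExponential.e^-expansion
    (Complex.commutativeRing (RealNumbers.commutativeRing ℝ)) (ComplexNumbers.ℕ-unit ℝ)
    {Complex.ofReal (RealNumbers.commutativeRing ℝ) lam} (Degenerate.lam-unit ℝ lam lam#0)
    {Degenerate.e^ ℝ lam lam#0 z} z (e^≡ z)

  e^0≈1 : ∀ z → z ≈ 0# → Degenerate.e^ ℝ lam lam#0 z ≈ₛ 1ₛ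
  e^0≈1 z = DegenerateExponential.e^0≈1
    (Complex.commutativeRing (RealNumbers.commutativeRing ℝ)) (ComplexNumbers.ℕ-unit ℝ)
    {Complex.ofReal (RealNumbers.commutativeRing ℝ) lam} (Degenerate.lam-unit ℝ lam lam#0)
    {Degenerate.e^ ℝ lam lam#0 z} {z} (e^≡ z)

  cos^-expansion : ∀ y →
    ExponentialGeneratingFunctions.StirlingExpansion
      (Complex.commutativeRing (RealNumbers.commutativeRing ℝ)) (ComplexNumbers.ℕ-unit ℝ)
      (Complex.ofReal (RealNumbers.commutativeRing ℝ) lam)
      (cosPower (Complex.ofReal (RealNumbers.commutativeRing ℝ) y))
      (Degenerate.cos^ ℝ lam lam#0 y)
  cos^-expansion y = cos-expansion
    {Complex.ofReal (RealNumbers.commutativeRing ℝ) lam}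
    {Complex.ofReal (RealNumbers.commutativeRing ℝ) y}
    {Degenerate.e^ ℝ lam lam#0
      (Complex.i (RealNumbers.commutativeRing ℝ) * Complex.ofReal (RealNumbers.commutativeRing ℝ) y)}
    {Degenerate.e^ ℝ lam lam#0
      (- (Complex.i (RealNumbers.commutativeRing ℝ) * Complex.ofReal (RealNumbers.commutativeRing ℝ) y))}
    (e^-expansion
      (Complex.i (RealNumbers.commutativeRing ℝ) * Complex.ofReal (RealNumbers.commutativeRing ℝ) y))
    (e^-expansion
      (- (Complex.i (RealNumbers.commutativeRing ℝ) * Complex.ofReal (RealNumbers.commutativeRing ℝ) y)))

  sin^-expansion : ∀ y →
    ExponentialGeneratingFunctions.StirlingExpansion
      (Complex.commutativeRing (RealNumbers.commutativeRing ℝ)) (ComplexNumbers.ℕ-unit ℝ)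
      (Complex.ofReal (RealNumbers.commutativeRing ℝ) lam)
      (sinPower (Complex.ofReal (RealNumbers.commutativeRing ℝ) y))
      (Degenerate.sin^ ℝ lam lam#0 y)
  sin^-expansion y = sin-expansion
    {Complex.ofReal (RealNumbers.commutativeRing ℝ) lam}
    {Complex.ofReal (RealNumbers.commutativeRing ℝ) y}
    {Degenerate.e^ ℝ lam lam#0
      (Complex.i (RealNumbers.commutativeRing ℝ) * Complex.ofReal (RealNumbers.commutativeRing ℝ) y)}
    {Degenerate.e^ ℝ lam lam#0
      (- (Complex.i (RealNumbers.commutativeRing ℝ) * Complex.ofReal (RealNumbers.commutativeRing ℝ) y))}
    (e^-expansion
      (Complex.i (RealNumbers.commutativeRing ℝ) * Complex.ofReal (RealNumbers.commutativeRing ℝ) y))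
    (e^-expansion
      (- (Complex.i (RealNumbers.commutativeRing ℝ) * Complex.ofReal (RealNumbers.commutativeRing ℝ) y)))

theorem2p3 :
  ∀ {c ℓ₁ ℓ₂} (ℝ : RealNumbers c ℓ₁ ℓ₂) →
  let
    open RealNumbers ℝ using (_#_)
    open RealNumbers ℝ using () renaming (Carrier to Real)
    open RealNumbers ℝ using () renaming (0# to 0ᴿ)
    open ComplexNumbers ℝ
    open Stirling using (S⁽¹⁾)
  in
  (lam : Real) (lam#0 : lam # 0ᴿ) (x y : Real) →
  let
    open Degenerate ℝ lam lam#0
  in
  ((n : ℕ) →
    (𝓔⁽ᶜ⁾ n x y
      ≈ Σ[ k from 0 to n ] ((n C k) · (𝓔₀ k * 𝓒 (n ∸ k) x y)))
    ×
    (Σ[ k from 0 to n ] ((n C k) · (𝓔₀ k * 𝓒 (n ∸ k) x y))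
      ≈ Σ[ k from 0 to ⌊ n /2⌋ ] (Σ[ l from 2 *ℕ k to n ]
          ((n C l) · (ofReal lam ^ (l ∸ 2 *ℕ k) * (- 1#) ^ k * ofReal y ^ (2 *ℕ k)
                       * fromℤ (S⁽¹⁾ l (2 *ℕ k)) * 𝓔 (n ∸ l) x)))))
  ×
  ((n : ℕ) → 1 ≤ n →
    (𝓔⁽ˢ⁾ n x y
      ≈ Σ[ k from 0 to n ] ((n C k) · (𝓔₀ k * 𝓢 (n ∸ k) x y)))
    ×
    (Σ[ k from 0 to n ] ((n C k) · (𝓔₀ k * 𝓢 (n ∸ k) x y))
      ≈ Σ[ k from 0 to ⌊ n ∸ 1 /2⌋ ] (Σ[ l from 2 *ℕ k +ℕ 1 to n ]
          ((n C l) · (ofReal lam ^ (l ∸ 2 *ℕ k ∸ 1) * (- 1#) ^ k * ofReal y ^ (2 *ℕ k +ℕ 1)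
                       * fromℤ (S⁽¹⁾ l (2 *ℕ k +ℕ 1)) * 𝓔 (n ∸ l) x)))))
theorem2p3 ℝ lam lam#0 x y =
  convolution-cos
    {Complex.ofReal (RealNumbers.commutativeRing ℝ) lam}
    {Complex.ofReal (RealNumbers.commutativeRing ℝ) y}
    {Degenerate.2/[e+1] ℝ lam lam#0}
    {Degenerate.e^ ℝ lam lam#0
      (Complex.ofReal (RealNumbers.commutativeRing ℝ) (HeytingField.0# (RealNumbers.heytingField ℝ)))}
    {Degenerate.e^ ℝ lam lam#0 (Complex.ofReal (RealNumbers.commutativeRing ℝ) x)}
    {Degenerate.cos^ ℝ lam lam#0 y}
    {λ n → Degenerate.𝓔 ℝ lam lam#0 n (HeytingField.0# (RealNumbers.heytingField ℝ))}
    {λ n → Degenerate.𝓔 ℝ lam lam#0 n x}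
    {λ n → Degenerate.𝓒 ℝ lam lam#0 n x y}
    {λ n → Degenerate.𝓔⁽ᶜ⁾ ℝ lam lam#0 n x y}
    -- The embedded real zero is definitionally the zero of ℂ, so `refl` shows that the exponent
    -- vanishes.
    (e^0≈1 (Complex.ofReal (RealNumbers.commutativeRing ℝ) (HeytingField.0# (RealNumbers.heytingField ℝ))) refl)
    (cos^-expansion y)
    (λ n → ≡.refl) (λ n → ≡.refl) (λ n → ≡.refl) (λ n → ≡.refl) ,
  convolution-sin
    {Complex.ofReal (RealNumbers.commutativeRing ℝ) lam}
    {Complex.ofReal (RealNumbers.commutativeRing ℝ) y}
    {Degenerate.2/[e+1] ℝ lam lam#0}
    {Degenerate.e^ ℝ lam lam#0
      (Complex.ofReal (RealNumbers.commutativeRing ℝ) (HeytingField.0# (RealNumbers.heytingField ℝ)))}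
    {Degenerate.e^ ℝ lam lam#0 (Complex.ofReal (RealNumbers.commutativeRing ℝ) x)}
    {Degenerate.sin^ ℝ lam lam#0 y}
    {λ n → Degenerate.𝓔 ℝ lam lam#0 n (HeytingField.0# (RealNumbers.heytingField ℝ))}
    {λ n → Degenerate.𝓔 ℝ lam lam#0 n x}
    {λ n → Degenerate.𝓢 ℝ lam lam#0 n x y}
    {λ n → Degenerate.𝓔⁽ˢ⁾ ℝ lam lam#0 n x y}
    (e^0≈1 (Complex.ofReal (RealNumbers.commutativeRing ℝ) (HeytingField.0# (RealNumbers.heytingField ℝ))) refl)
    (sin^-expansion y)
    (λ n → ≡.refl) (λ n → ≡.refl) (λ n → ≡.refl) (λ n → ≡.refl)
  where
  open CommutativeRing (Complex.commutativeRing (RealNumbers.commutativeRing ℝ)) using (refl)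
  open DegenerateExpansions ℝ lam lam#0
  open Trigonometric
    (Complex.commutativeRing (RealNumbers.commutativeRing ℝ)) (ComplexNumbers.ℕ-unit ℝ)
    {Complex.i (RealNumbers.commutativeRing ℝ)} (Complex.i-unit (RealNumbers.commutativeRing ℝ))
    (i*i≈-1 (RealNumbers.commutativeRing ℝ))
    using (convolution-cos; convolution-sin)
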